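{- Let $G$ and $H$ be finite groups and let $m>1$ be an integer. Then the graphs $\mathscr{G}_m(G)$ and $\mathscr{G}_m(H)$ are isomorphic if and only if the groups $G$ and $H$ are isomorphic.
   Context: For a finite group $G$ with identity $e$, write $G^\times=G\setminus\{e\}$. For $x\in G^\times$ and integers $1\leqslant k<l\leqslant m+1$, let $\mathbf{x}_{[k,l)}\in G^m$ be the $m$-tuple whose $j$-th coordinate equals $x$ for $k\leqslant j<l$ and equals $e$ otherwise. The interval $\mathcal{S}_{[k,l)}$ is the set $\{\mathbf{x}_{[k,l)}: x\in G^\times\}$, and $\mathcal{S}=\mathcal{S}(m)$ is the union of all intervals $\mathcal{S}_{[k,l)}$, $1\leqslant k<l\leqslant m+1$. The graph $\mathscr{G}_m(G)$ is the Cayley graph $Cay(G^m,\mathcal{S})$: its vertex set is the direct power $G^m$ (coordinatewise multiplication), and vertices $\mathbf{g},\mathbf{h}$ are adjacent iff $\mathbf{h}=\mathbf{s}\mathbf{g}$ for some $\mathbf{s}\in\mathcal{S}$ (equivalently $\mathbf{h}\mathbf{g}^{ -1}\in\mathcal{S}$). -}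

module Defs where

open import Level using (0ℓ)
open import Data.Nat using (ℕ; _≤_; _<_; _≤?_; _<?_)
open import Data.Fin using (Fin; toℕ)
open import Data.Vec using (Vec; tabulate; zipWith)
open import Data.Bool using (if_then_else_)
open import Data.Product using (Σ; _×_; ∃-syntax)
open import Relation.Nullary using (¬_; does)
open import Relation.Binary.PropositionalEquality using (_≡_)
open import Algebra.Structures using (IsGroup)
open import Function.Bundles using (_↔_; Inverse)

record FiniteGroup : Set₁ where
  infixl 7 _∙_
  field
    Carrier : Set
    _∙_     : Carrier → Carrier → Carrier
    ε       : Carrier
    _⁻¹     : Carrier → Carrier
    isGroup : IsGroup _≡_ _∙_ ε _⁻¹
    size    : ℕ
    finite  : Carrier ↔ Fin size

open FiniteGroup public

module _ (G : FiniteGroup) (m : ℕ) where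
  private
    C = Carrier G

  -- x_[k,l) with 0-based coordinates: coordinate j is x iff k ≤ j < l, else e.
  -- (paper's 1-based [k,l) with 1 ≤ k < l ≤ m+1 corresponds to 0 ≤ k < l ≤ m)
  intervalElem : C → ℕ → ℕ → Vec C m
  intervalElem x k l = tabulate λ j →
    if does (k ≤? toℕ j) then (if does (toℕ j <? l) then x else ε G) else ε G

  InS : Vec C m → Set
  InS s = ∃[ x ] ∃[ k ] ∃[ l ]
            (¬ (x ≡ ε G) × k < l × l ≤ m × s ≡ intervalElem x k l)

  -- adjacency in the Cayley graph 𝒢_m(G) = Cay(G^m, 𝒮): h = s g with s ∈ 𝒮
  Adj : Vec C m → Vec C m → Set
  Adj g h = ∃[ s ] (InS s × h ≡ zipWith (_∙_ G) s g)

record GraphIso (G H : FiniteGroup) (m : ℕ) : Set where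
  field
    bij   : Vec (Carrier G) m ↔ Vec (Carrier H) m
    pres  : ∀ g h → Adj G m g h → Adj H m (Inverse.to bij g) (Inverse.to bij h)
    refl′ : ∀ g h → Adj H m (Inverse.to bij g) (Inverse.to bij h) → Adj G m g h

record GroupIso (G H : FiniteGroup) : Set where
  field
    bij   : Carrier G ↔ Carrier H
    hom   : ∀ x y → Inverse.to bij (_∙_ G x y) ≡ _∙_ H (Inverse.to bij x) (Inverse.to bij y)

{-# OPTIONS --safe #-}

-- Replacing g ∈ G^m by the word of quotients gᵢ⁻¹gᵢ₊₁ (with g₀ = gₘ₊₁ = e)
-- identifies the vertices with the words of length m + 1 over G of product e,
-- and two vertices are adjacent iff their words differ in exactly two
-- positions. Any m symbols of a word determine the remaining one, and most of
-- the argument only uses this.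
--
-- Suppose |G| ≥ 5. Five words on a line (the words agreeing outside two fixed
-- positions) are sent to a clique, which lies on a line or in a star (the words
-- one symbol away from a fixed non-word). Stars are ruled out, so collinearity
-- is preserved. The three lines through the origin in a plane (three free
-- positions) are then sent to the three lines of a plane, which gives an isotopy
-- between the relations xyz = e of the two groups, hence an isomorphism.
--
-- For |G| ≤ 4 the order determines the group unless it is 4, and the two groups
-- of order 4 are told apart by the common neighbours of an edge: over a group of
-- exponent 2 they form at most two connected components, and some edge has three
-- if there is an x with x² ≠ e.
module Submission where

open import Defs
open import Level using (0ℓ)
open import Algebra.Bundles using (Group)
import Algebra.Properties.Group as GroupProperties
open import Data.Nat as ℕ using (ℕ; zero; suc; s≤s; NonZero; _<_; _^_; _%_; _/_)
open import Data.Nat.DivMod using (m%n<n; m≡m%n+[m/n]*n)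
import Data.Nat.Properties as ℕ
open import Data.Fin as Fin using (Fin; zero; suc; toℕ; fromℕ<; _≟_)
open import Data.Fin.Permutation using (↔⇒≡)
import Data.Fin.Properties as Fin
open import Data.Vec using (Vec; []; _∷_; zipWith; replicate; map)
open import Data.Vec.Functional using (updateAt)
open import Data.Vec.Functional.Properties using (updateAt-updates; updateAt-minimal)
open import Data.Vec.Properties
  using (≡-dec; zipWith-assoc; zipWith-identityʳ; zipWith-inverseˡ; zipWith-inverseʳ;
         map-id; map-cong; map-∘)
open import Data.List using (List; []; _∷_; length; lookup)
import Data.List.Membership.DecPropositional as DecMembership
open import Data.List.Membership.Propositional using (_∈_; _∉_)
open import Data.List.Membership.Propositional.Properties using (∈-lookup)
open import Data.List.Membership.Setoid.Properties using ()
  renaming (index-injective to ∈-index-injective)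
open import Data.List.Relation.Unary.All as All using ([]; _∷_)
open import Data.List.Relation.Unary.AllPairs using ([]; _∷_)
open import Data.List.Relation.Unary.Any using (here; there) renaming (index to ∈-index)
open import Data.List.Relation.Unary.Unique.Propositional using (Unique)
open import Data.Product using (_×_; _,_; proj₁; proj₂; ∃; ∃₂)
open import Data.Product.Function.NonDependent.Propositional using (_×-↔_)
open import Data.Sum using (_⊎_; inj₁; inj₂)
open import Data.Empty using (⊥; ⊥-elim)
open import Function using (_∘_; const)
open import Function.Bundles using (_↔_; Inverse; mk↔ₛ′)
open import Function.Properties.Inverse using (↔-sym; ↔-trans)
open import Relation.Nullary using (¬_; Dec; yes; no; contradiction)
open import Relation.Nullary.Decidable using (map′; ¬?; _×-dec_; decidable-stable)
open import Relation.Binary.Definitions using (DecidableEquality; tri<; tri≈; tri>)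
open import Relation.Binary.PropositionalEquality

-- Codes in which any one symbol is determined by the others

-- To the graph, lines and stars look alike: both consist of pairwise adjacent vertices. They are
-- told apart by the vertices around them. A word `v` off a line that is near two of its points is
-- near no third one, but it can be reached from a further point of the line through a word that is
-- near neither of the two. Around a star there is a corresponding `v` that admits no such detour
-- (`star-square`). The detour from a single point may fail, while out of two starting points one
-- always works. Together with the three points that define `v` this takes five points on a line,
-- which is where the bound 5 on the order comes from.
--
-- A graph isomorphism may also move the origin and permute the positions. The first is undone by a
-- right translation. As to the second, a relation xyz = e survives a cyclic change of order, and a
-- reversal is undone by passing to inverses, so only two of the six orders need separate treatment.

record Code : Set₁ where
  infix 8 _at_
  infix 4 _≟ₛ_
  field
    Symbol : Set
    Word   : Set
    len    : ℕ
    _at_   : Word → Fin len → Symbol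
    _≟ₛ_   : DecidableEquality Symbol

  Pos : Set
  Pos = Fin len

  Off : Word → Word → Pos → Pos → Set
  Off u v a b = ∀ {i} → i ≢ a → i ≢ b → u at i ≡ v at i

  -- Includes `u ≡ v`: this is the reflexive closure of adjacency, so cliques need no separate
  -- treatment of coinciding words.
  Near : Word → Word → Set
  Near u v = ∃₂ λ a b → Off u v a b

  Diff : Word → Word → Pos → Set
  Diff u v i = u at i ≢ v at i

  field
    ext  : ∀ {u v j} → (∀ {i} → i ≢ j → u at i ≡ v at i) → u ≡ v
    move : ∀ u i x j → i ≢ j → ∃ λ w → Off w u i j × w at i ≡ x

module CodeProperties (C : Code) where
  open Code C

  private variable
    u v w s t : Word
    a b c d i j k : Pos

  diff-sym : Diff u v i → Diff v u i
  diff-sym d = d ∘ sym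

  diff-substʳ : w at i ≡ v at i → Diff u v i → Diff u w i
  diff-substʳ e d p = d (trans p e)

  diff-substˡ : w at i ≡ u at i → Diff u v i → Diff w v i
  diff-substˡ e d p = d (trans (sym e) p)

  off-refl : Off u u a b
  off-refl _ _ = refl

  off-sym : Off u v a b → Off v u a b
  off-sym o i≢a i≢b = sym (o i≢a i≢b)

  off-swap : Off u v a b → Off u v b a
  off-swap o i≢b i≢a = o i≢a i≢b

  off-trans : Off u v a b → Off v w a b → Off u w a b
  off-trans o o′ i≢a i≢b = trans (o i≢a i≢b) (o′ i≢a i≢b)

  off-extˡ : Off u v a b → u at a ≡ v at a → u ≡ v
  off-extˡ {a = a} o e = ext λ {i} i≢b → case-at i i≢b
    where
    case-at : ∀ i → i ≢ _ → _ at i ≡ _ at i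
    case-at i i≢b with i ≟ a
    ... | yes refl = e
    ... | no i≢a   = o i≢a i≢b

  off-extʳ : Off u v a b → u at b ≡ v at b → u ≡ v
  off-extʳ o = off-extˡ (off-swap o)

  off-diffˡ : Off u v a b → u ≢ v → Diff u v a
  off-diffˡ o u≢v = u≢v ∘ off-extˡ o

  off-diffʳ : Off u v a b → u ≢ v → Diff u v b
  off-diffʳ o u≢v = u≢v ∘ off-extʳ o

  off-≢ : Off u v a b → u ≢ v → a ≢ b
  off-≢ o u≢v refl = u≢v (ext λ i≢a → o i≢a i≢a)

  off-through : Off u v a b → Off u w a c → v at a ≡ w at a → Off v w b c
  off-through {a = a} o o′ e {i} i≢b i≢c with i ≟ a
  ... | yes refl = e
  ... | no i≢a   = trans (sym (o i≢a i≢b)) (o′ i≢a i≢c)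

  off⇒near : Off u v a b → Near u v
  off⇒near o = _ , _ , o

  near-sym : Near u v → Near v u
  near-sym (a , b , o) = a , b , off-sym o

  ≢-at : Diff u v i → u ≢ v
  ≢-at d refl = d refl

  off-pin : Off u v a i → b ≢ a → Diff u v b → i ≡ b
  off-pin {i = i} {b = b} o b≢a d with b ≟ i
  ... | yes refl = refl
  ... | no b≢i   = ⊥-elim (d (o b≢a b≢i))

  near-diff : Near u v → Diff u v a → ∃ λ i → Off u v a i
  near-diff {a = a} (s , t , o) d with a ≟ s | a ≟ t
  ... | yes refl | _        = t , o
  ... | no _     | yes refl = s , off-swap o
  ... | no a≢s   | no a≢t   = ⊥-elim (d (o a≢s a≢t))

  near-diff₂ : Near u v → a ≢ b → Diff u v a → Diff u v b → Off u v a b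
  near-diff₂ n a≢b da db with near-diff n da
  ... | i , o with off-pin o (≢-sym a≢b) db
  ... | refl = o

  -- The usual source of non-adjacency below: three positions of difference exceed the two allowed.
  near-diff₃ : Near u v → a ≢ b → c ≢ a → c ≢ b →
               Diff u v a → Diff u v b → ¬ Diff u v c
  near-diff₃ n a≢b c≢a c≢b da db dc = dc (near-diff₂ n a≢b da db c≢a c≢b)

  off? : ∀ u v a b → Off u v a b ⊎ ∃ λ c → c ≢ a × c ≢ b × Diff u v c
  off? u v a b
    with Fin.any? (λ c → ¬? (c ≟ a) ×-dec ¬? (c ≟ b) ×-dec ¬? (u at c ≟ₛ v at c))
  ... | yes c = inj₂ c
  ... | no ∄c = inj₁ λ {i} i≢a i≢b →
    decidable-stable (u at i ≟ₛ v at i) λ d → ∄c (i , i≢a , i≢b , d)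

  Col : Word → Word → Word → Set
  Col u v w = ∃₂ λ a b → Off u v a b × Off u w a b

  -- Distinct near words differ at exactly two positions, so these determine the line through them.
  col-pin : Col u v w → u ≢ v → Off u v a b → Off u w a b
  col-pin {a = a} (s , t , ov , ow) u≢v o with a ≟ s | a ≟ t
  ... | yes refl | _ with off-pin ov (≢-sym (off-≢ o u≢v)) (off-diffʳ o u≢v)
  ...   | refl = ow
  col-pin (s , t , ov , ow) u≢v o | no _ | yes refl
    with off-pin (off-swap ov) (≢-sym (off-≢ o u≢v)) (off-diffʳ o u≢v)
  ... | refl = off-swap ow
  col-pin (s , t , ov , ow) u≢v o | no a≢s | no a≢t = ⊥-elim (off-diffˡ o u≢v (ov a≢s a≢t))

  -- `u` and `v` differ at both `a` and `b`, while `w` can differ from each of them at only one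
  -- position besides `c`. Hence `w` shares its symbol at `a` with one of them and its symbol at `b`
  -- with the other.
  off-line : Off u v a b → u ≢ v → Near w u → Near w v →
             c ≢ a → c ≢ b → Diff w u c →
             (Off w u b c × Off w v a c) ⊎ (Off w u a c × Off w v b c)
  off-line {u} {v} {a} {b} {w} {c} o u≢v wu wv c≢a c≢b d
    with near-diff wu d | near-diff wv (diff-substʳ (sym (o c≢a c≢b)) d)
  ... | i , ou | j , ov with i ≟ b
  ...   | yes refl
          with off-pin ov (≢-sym c≢a)
                 (diff-substˡ (ou (≢-sym c≢a) (off-≢ o u≢v)) (off-diffˡ o u≢v))
  ...     | refl = inj₁ (off-swap ou , off-swap ov)
  off-line {u} {v} {a} {b} {w} {c} o u≢v wu wv c≢a c≢b d
    | i , ou | j , ov | no i≢b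
    with off-pin ov (≢-sym c≢b)
           (diff-substˡ (ou (≢-sym c≢b) (≢-sym i≢b)) (off-diffʳ o u≢v))
  ... | refl
    with off-pin ou (≢-sym c≢a)
           (diff-substˡ (ov (≢-sym c≢a) (off-≢ o u≢v)) (diff-sym (off-diffˡ o u≢v)))
  ...   | refl = inj₂ (off-swap ou , off-swap ov)

  module _ {t₁ t₂ : Word} (o₂ : Off t₁ t₂ a b) (t₁≢t₂ : t₁ ≢ t₂)
           (c≢a : c ≢ a) (c≢b : c ≢ b) (vc : Diff v t₁ c)
           (v₁ : Off v t₁ b c) (v₂ : Off v t₂ a c) where

    private
      a≢b : a ≢ b
      a≢b = off-≢ o₂ t₁≢t₂

      va : v at a ≡ t₁ at a
      va = v₁ a≢b (≢-sym c≢a)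

      vb : v at b ≡ t₂ at b
      vb = v₂ (≢-sym a≢b) (≢-sym c≢b)

    -- `v` has the symbol of `t₁` at `a` and that of `t₂` at `b`, so a third point of the line
    -- differs from it at both, and at `c` as well.
    third-not-near : ∀ {t₃} → Off t₁ t₃ a b → t₁ ≢ t₃ → t₂ ≢ t₃ → ¬ Near v t₃
    third-not-near o₃ t₁≢t₃ t₂≢t₃ n = near-diff₃ n a≢b c≢a c≢b
      (diff-substˡ va (off-diffˡ o₃ t₁≢t₃))
      (diff-substˡ vb (off-diffʳ (off-trans (off-sym o₂) o₃) t₂≢t₃))
      (diff-substʳ (sym (o₃ c≢a c≢b)) vc)

    private
      -- `w` copies `x` at `a` and `v` at `c`, and `b` compensates. Being near `t₂` would force
      -- `w ≡ v`. Being near `t₁` cannot be excluded, but it fixes the symbol at `b`.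
      detour : ∀ {x} → Off t₁ x a b → t₁ ≢ x → t₂ ≢ x →
               ∃ λ w → Off w x c b × w at c ≡ v at c × Near w v ×
                       ¬ Near w t₂ × (Near w t₁ → w at b ≡ t₁ at b)
      detour {x} ox t₁≢x t₂≢x with move x c (v at c) b c≢b
      ... | w , wx , wc = w , wx , wc , off⇒near wv , not₂ , is₁
        where
        wv : Off w v a b
        wv {i} i≢a i≢b with i ≟ c
        ... | yes refl = wc
        ... | no i≢c   = trans (wx i≢c i≢b) (trans (sym (ox i≢a i≢b)) (sym (v₁ i≢b i≢c)))

        wa : w at a ≡ x at a
        wa = wx (≢-sym c≢a) a≢b

        w₁ : Diff w t₁ c
        w₁ = diff-substˡ wc vc

        is₁ : Near w t₁ → w at b ≡ t₁ at b
        is₁ n = near-diff₂ n (≢-sym c≢a) (diff-substˡ wa (diff-sym (off-diffˡ ox t₁≢x))) w₁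
                  (≢-sym a≢b) (≢-sym c≢b)

        not₂ : ¬ Near w t₂
        not₂ n = off-diffˡ ox t₁≢x (trans (sym va) (trans (cong (_at a) (sym w≡v)) wa))
          where
          w₂ : Off w t₂ a c
          w₂ = near-diff₂ n (≢-sym c≢a)
                 (diff-substˡ wa (diff-sym (off-diffˡ (off-trans (off-sym o₂) ox) t₂≢x)))
                 (diff-substʳ (sym (o₂ c≢a c≢b)) w₁)

          w≡v : w ≡ v
          w≡v = off-extʳ wv (trans (w₂ (≢-sym a≢b) (≢-sym c≢b)) (sym vb))

    -- If the detours from `x` and from `y` were both near `t₁`, they would have the same symbol at
    -- `b` and so coincide, although at `a` they carry the different symbols of `x` and `y`.
    detour-avoiding : ∀ {x y} → Off t₁ x a b → Off t₁ y a b →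
                      t₁ ≢ x → t₂ ≢ x → t₁ ≢ y → t₂ ≢ y → x ≢ y →
                      ∃ λ w → (Near w x ⊎ Near w y) × Near w v × ¬ Near w t₁ × ¬ Near w t₂
    detour-avoiding ox oy t₁≢x t₂≢x t₁≢y t₂≢y x≢y
      with detour ox t₁≢x t₂≢x | detour oy t₁≢y t₂≢y
    ... | w , wx , wc , wv , w₂ , w₁ | w′ , w′y , w′c , w′v , w′₂ , w′₁
      with w at b ≟ₛ t₁ at b | w′ at b ≟ₛ t₁ at b
    ... | no ≢ | _ = w , inj₁ (off⇒near wx) , wv , ≢ ∘ w₁ , w₂
    ... | yes _ | no ≢ = w′ , inj₂ (off⇒near w′y) , w′v , ≢ ∘ w′₁ , w′₂
    ... | yes wb | yes w′b = ⊥-elim (off-diffˡ oxy x≢y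
            (trans (sym (wx (≢-sym c≢a) a≢b))
              (trans (cong (_at a) w≡w′) (w′y (≢-sym c≢a) a≢b))))
      where
      oxy = off-trans (off-sym ox) oy

      ww′ : Off w w′ a b
      ww′ {i} i≢a i≢b with i ≟ c
      ... | yes refl = trans wc (sym w′c)
      ... | no i≢c   = trans (wx i≢c i≢b) (trans (oxy i≢a i≢b) (sym (w′y i≢c i≢b)))

      w≡w′ : w ≡ w′
      w≡w′ = off-extʳ ww′ (trans wb (sym w′b))

  -- A star is the set of words that differ in one position from a fixed
  -- non-word p; On p x i says that x is p altered at i.
  On : (Pos → Symbol) → Word → Pos → Set
  On p x i = ∀ {k} → k ≢ i → x at k ≡ p k

  module Star (p : Pos → Symbol) where

    private variable
      x y z : Word

    on-off : On p x i → On p y j → Off x y i j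
    on-off ox oy k≢i k≢j = trans (ox k≢i) (sym (oy k≢j))

    on-≢ : On p x i → On p y j → x ≢ y → i ≢ j
    on-≢ ox oy = off-≢ (on-off ox oy)

    on-diff : On p x i → On p y j → x ≢ y → x at i ≢ p i
    on-diff ox oy x≢y e =
      off-diffˡ (on-off ox oy) x≢y (trans e (sym (oy (on-≢ ox oy x≢y))))

    module _ (ou : On p u a) (ov : On p v b) (ow : On p w c)
             (u≢v : u ≢ v) (u≢w : u ≢ w) (v≢w : v ≢ w) where

      private
        a≢b = on-≢ ou ov u≢v
        a≢c = on-≢ ou ow u≢w
        b≢c = on-≢ ov ow v≢w
        ua = on-diff ou ov u≢v
        vb = on-diff ov ow v≢w
        wc = on-diff ow (λ {k} → ou {k}) (≢-sym u≢w)

      -- In a direct power of groups exceptional neighbours arise from involutions.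
      Exceptional : Word → Set
      Exceptional s = Off s w a b × s at a ≡ u at a × s at b ≢ p b

      -- If `s` agrees with `p` at `a` (or at `b`), it differs there from `u` (or `v`), and at most
      -- one other position can depart from `p`. Otherwise `s` differs from `w` at `a` and `b`,
      -- agrees with it at `c`, and so departs from `p` at all three.
      fourth : Near s u → Near s v → Near s w → ∃ (On p s) ⊎ Exceptional s
      fourth {s} su sv sw with s at a ≟ₛ p a | s at b ≟ₛ p b
      ... | no sa | no sb = inj₂ (s-w , s-u a≢b a≢c , sb)
        where
        s-w = near-diff₂ sw a≢b (λ e → sa (trans e (ow a≢c))) (λ e → sb (trans e (ow b≢c)))
        s-u = near-diff₂ su b≢c (λ e → sb (trans e (ou (≢-sym a≢b))))
                (λ e → wc (trans (sym (s-w (≢-sym a≢c) (≢-sym b≢c))) (trans e (ou (≢-sym a≢c)))))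
      ... | no sa | yes sb with near-diff sv (λ e → sa (trans e (ov a≢b)))
      ...   | i , o with off-pin o (≢-sym a≢b) (λ e → vb (trans (sym e) sb))
      ...     | refl = inj₁ (a , on)
        where
        on : On p s a
        on {k} k≢a with k ≟ b
        ... | yes refl = sb
        ... | no k≢b   = trans (o k≢a k≢b) (ov k≢b)
      fourth {s} su sv sw | yes sa | _ with near-diff su (λ e → ua (trans (sym e) sa))
      ... | i , o = inj₁ (i , on)
        where
        on : On p s i
        on {k} k≢i with k ≟ a
        ... | yes refl = sa
        ... | no k≢a   = trans (o k≢a k≢i) (ou k≢a)

      exceptional-unique : Exceptional s → Exceptional t → s ≡ t
      exceptional-unique (os , sa , _) (ot , ta , _) =
        off-extˡ (off-trans os (off-sym ot)) (trans sa (sym ta))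

      exceptional-far : Exceptional s → On p t d → t ≢ u → t ≢ v → t ≢ w → ¬ Near s t
      exceptional-far (os , sa , sb) ot t≢u t≢v t≢w n = near-diff₃ n a≢b (≢-sym a≢c) (≢-sym b≢c)
        (λ e → ua (trans (sym sa) (trans e (ot (≢-sym (on-≢ ot ou t≢u))))))
        (λ e → sb (trans e (ot (≢-sym (on-≢ ot ov t≢v)))))
        (λ e → wc (trans (sym (os (≢-sym a≢c) (≢-sym b≢c)))
                     (trans e (ot (≢-sym (on-≢ ot ow t≢w))))))

    -- v is p altered at b, c and d, matching t₁ at b and t₂ at c.
    star-square : ∀ {t₁ t₂ t₃} → On p t₁ b → On p t₂ c → On p t₃ d →
      t₁ ≢ t₂ → t₁ ≢ t₃ → t₂ ≢ t₃ →
      ∃ λ v → Near v t₁ × Near v t₂ ×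
        (∀ {u a} → On p u a → u ≢ t₁ → u ≢ t₂ → u ≢ t₃ →
          ¬ Near v u ×
          (∀ {w} → Near w u → Near w v → Near w t₁ ⊎ Near w t₂ ⊎ Near v t₃))
    star-square {b} {c} {d} {t₁} {t₂} {t₃} o₁ o₂ o₃ t₁≢t₂ t₁≢t₃ t₂≢t₃
      with move t₁ c (t₂ at c) d (on-≢ o₂ o₃ t₂≢t₃)
    ... | v , v₁ , vc = v , off⇒near v₁ , off⇒near v₂ , λ ou n₁ n₂ n₃ → far ou n₁ n₂ n₃ , square ou n₁ n₂ n₃
      where
      b≢c = on-≢ o₁ o₂ t₁≢t₂
      b≢d = on-≢ o₁ o₃ t₁≢t₃
      c≢d = on-≢ o₂ o₃ t₂≢t₃

      vb : v at b ≡ t₁ at b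
      vb = v₁ b≢c b≢d

      v₂ : Off v t₂ b d
      v₂ {k} k≢b k≢d with k ≟ c
      ... | yes refl = vc
      ... | no k≢c   = trans (v₁ k≢c k≢d) (trans (o₁ k≢b) (sym (o₂ k≢c)))

      vk : ∀ {k} → k ≢ b → k ≢ c → k ≢ d → v at k ≡ p k
      vk k≢b k≢c k≢d = trans (v₁ k≢c k≢d) (o₁ k≢b)

      vb≢ : v at b ≢ p b
      vb≢ e = on-diff o₁ o₂ t₁≢t₂ (trans (sym vb) e)

      vc≢ : v at c ≢ p c
      vc≢ e = on-diff o₂ o₃ t₂≢t₃ (trans (sym vc) e)

      vd≢ : v at d ≢ p d
      vd≢ e = vc≢ (trans (cong (_at c) (off-extʳ v₁ (trans e (sym (o₁ (≢-sym b≢d)))))) (o₁ (≢-sym b≢c)))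

      module _ {u a} (ou : On p u a) (u≢t₁ : u ≢ t₁) (u≢t₂ : u ≢ t₂) (u≢t₃ : u ≢ t₃) where
        a≢b = on-≢ ou o₁ u≢t₁
        a≢c = on-≢ ou o₂ u≢t₂
        a≢d = on-≢ ou o₃ u≢t₃

        va : v at a ≡ p a
        va = vk a≢b a≢c a≢d

        ua≢ : u at a ≢ p a
        ua≢ = on-diff ou o₁ u≢t₁

        far : ¬ Near v u
        far n = near-diff₃ n a≢b (≢-sym a≢c) (≢-sym b≢c)
          (λ e → ua≢ (trans (sym e) va))
          (λ e → vb≢ (trans e (ou (≢-sym a≢b))))
          (λ e → vc≢ (trans e (ou (≢-sym a≢c))))

        square : ∀ {w} → Near w u → Near w v → Near w t₁ ⊎ Near w t₂ ⊎ Near v t₃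
        square {w} wu wv with w at b ≟ₛ v at b | w at c ≟ₛ v at c
        ... | yes wb | _ with near-diff wu (λ e → vb≢ (trans (sym wb) (trans e (ou (≢-sym a≢b)))))
        ...   | i , o = inj₁ (off⇒near λ {k} → w-t₁ {k})
          where
          w-t₁ : Off w t₁ a i
          w-t₁ {k} k≢a k≢i with k ≟ b
          ... | yes refl = trans wb vb
          ... | no k≢b   = trans (o k≢b k≢i) (trans (ou k≢a) (sym (o₁ k≢b)))
        square {w} wu wv | no _ | yes wc
          with near-diff wu (λ e → vc≢ (trans (sym wc) (trans e (ou (≢-sym a≢c)))))
        ... | i , o = inj₂ (inj₁ (off⇒near λ {k} → w-t₂ {k}))
          where
          w-t₂ : Off w t₂ a i
          w-t₂ {k} k≢a k≢i with k ≟ c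
          ... | yes refl = trans wc vc
          ... | no k≢c   = trans (o k≢c k≢i) (trans (ou k≢a) (sym (o₂ k≢c)))
        -- The two differences from `v` are used up at `b` and `c`, so `w` agrees with `p` at `a`
        -- and with `v` at `d`. Its differences from `u` are then `a` and `d`, which leaves `d` as
        -- the only position where `w` departs from `p`: it is `t₃`.
        square {w} wu wv | no wb | no wc = inj₂ (inj₂ (near-sym (subst (λ z → Near z v) w≡t₃ wv)))
          where
          w-v : Off w v b c
          w-v = near-diff₂ wv b≢c wb wc

          wa : w at a ≡ p a
          wa = trans (w-v a≢b a≢c) va

          w-u : Off w u a d
          w-u = near-diff₂ wu a≢d (λ e → ua≢ (trans (sym e) wa))
            (λ e → vd≢ (trans (sym (w-v (≢-sym b≢d) (≢-sym c≢d))) (trans e (ou (≢-sym a≢d)))))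

          w≡t₃ : w ≡ t₃
          w≡t₃ = ext {j = d} λ {k} k≢d → agree k k≢d
            where
            agree : ∀ k → k ≢ d → w at k ≡ t₃ at k
            agree k k≢d with k ≟ a
            ... | yes refl = trans wa (sym (o₃ k≢d))
            ... | no k≢a   = trans (w-u k≢a k≢d) (trans (ou k≢a) (sym (o₃ k≢d)))

  -- If `w` leaves the line of `u` and `v` at `c`, the centre of the star is `w` with its symbol at
  -- `c` reset to the common symbol of `u` and `v`; by `off-line` each of these two departs from it
  -- at one of `a` and `b`.
  triangle : Near u v → Near w u → Near w v → u ≢ v →
             Col u v w ⊎
             ∃ λ p → (∃ λ a → On p u a) × (∃ λ b → On p v b) × (∃ λ c → On p w c)
  triangle {u} {v} {w} (a , b , o) wu wv u≢v with off? w u a b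
  ... | inj₁ w-u = inj₁ (a , b , o , off-sym w-u)
  ... | inj₂ (c , c≢a , c≢b , d) = inj₂ (p , center (off-line o u≢v wu wv c≢a c≢b d))
    where
    p : Pos → Symbol
    p k with k ≟ c
    ... | yes _ = u at c
    ... | no _  = w at k

    on-w : On p w c
    on-w {k} k≢c with k ≟ c
    ... | yes k≡c = ⊥-elim (k≢c k≡c)
    ... | no _    = refl

    on : ∀ {x i} → x at c ≡ u at c → Off w x i c → On p x i
    on xc o′ {k} k≢i with k ≟ c
    ... | yes refl = xc
    ... | no k≢c   = sym (o′ k≢i k≢c)

    center : (Off w u b c × Off w v a c) ⊎ (Off w u a c × Off w v b c) → _
    center (inj₁ (w-u , w-v)) =
      (b , λ {k} → on refl w-u {k}) , (a , λ {k} → on (sym (o c≢a c≢b)) w-v {k}) , (c , λ {k} → on-w {k})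
    center (inj₂ (w-u , w-v)) =
      (a , λ {k} → on refl w-u {k}) , (b , λ {k} → on (sym (o c≢a c≢b)) w-v {k}) , (c , λ {k} → on-w {k})

-- Isomorphisms of codes preserve collinearity

record CodeIso (C D : Code) : Set where
  private
    module C = Code C
    module D = Code D
  field
    to         : C.Word → D.Word
    from       : D.Word → C.Word
    to-from    : ∀ w → to (from w) ≡ w
    injective  : ∀ {u v} → to u ≡ to v → u ≡ v
    to-near    : ∀ {u v} → C.Near u v → D.Near (to u) (to v)
    to-near⁻¹  : ∀ {u v} → D.Near (to u) (to v) → C.Near u v

  to-≢ : ∀ {u v} → u ≢ v → to u ≢ to v
  to-≢ u≢v = u≢v ∘ injective

module Collineation {C D : Code} (φ : CodeIso C D)
  (fresh : (a b c d : Code.Symbol C) → ∃ λ (q : Code.Symbol C) → q ≢ a × q ≢ b × q ≢ c × q ≢ d) where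

  open Code C
  open CodeProperties C
  private
    module D where
      open Code D public
      open CodeProperties D public
  open CodeIso φ

  private variable
    u v w : Word
    i j : Pos

  -- Five points on a line cannot be sent into a star: the word completing the
  -- square in the star comes from a word off the line with at most two
  -- neighbours on it.
  line-not-star : ∀ {p a b u x t₁ t₂ t₃} →
    Off t₁ t₂ a b → Off t₁ t₃ a b → Off t₁ u a b → Off t₁ x a b →
    t₁ ≢ t₂ → t₁ ≢ t₃ → t₂ ≢ t₃ →
    u ≢ t₁ → u ≢ t₂ → u ≢ t₃ → x ≢ t₁ → x ≢ t₂ → x ≢ t₃ → u ≢ x →
    ∃ (D.On p (to u)) → ∃ (D.On p (to x)) →
    ∃ (D.On p (to t₁)) → ∃ (D.On p (to t₂)) → ∃ (D.On p (to t₃)) → ⊥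
  line-not-star {p} {a} {b} {u} {x} {t₁} {t₂} {t₃} o₂ o₃ ou ox n₁₂ n₁₃ n₂₃
                u₁ u₂ u₃ x₁ x₂ x₃ u≢x (_ , pu) (_ , px) (_ , p₁) (_ , p₂) (_ , p₃)
    with D.Star.star-square p p₁ p₂ p₃ (to-≢ n₁₂) (to-≢ n₁₃) (to-≢ n₂₃)
  ... | v′ , v′₁ , v′₂ , square
    with off? (from v′) t₁ a b
  ... | inj₁ o = proj₁ (square pu (to-≢ u₁) (to-≢ u₂) (to-≢ u₃))
                   (subst (λ z → D.Near z (to u)) (to-from v′)
                     (to-near (off⇒near (off-trans o ou))))
  -- Off the line, `z` is not near `t₃`, and a detour from `u` or from `x` reaches `z` through a
  -- word near neither `t₁` nor `t₂`. All three alternatives of `square` fail for it.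
  ... | inj₂ (c , c≢a , c≢b , d) =
    contra (off-line o₂ n₁₂ (back v′₁) (back v′₂) c≢a c≢b d)
    where
    z : Word
    z = from v′

    back : ∀ {y} → D.Near v′ (to y) → Near z y
    back n = to-near⁻¹ (subst (λ z → D.Near z _) (sym (to-from v′)) n)

    forth : ∀ {w} → Near w z → D.Near (to w) v′
    forth n = subst (D.Near _) (to-from v′) (to-near n)

    blocked : ¬ Near z t₃ →
              ¬ (∃ λ w → (Near w u ⊎ Near w x) × Near w z × ¬ Near w t₁ × ¬ Near w t₂)
    blocked v₃ (w , wux , wv , w₁ , w₂) = case-of (square-at wux)
      where
      square-at : Near w u ⊎ Near w x → _
      square-at (inj₁ wu) = proj₂ (square pu (to-≢ u₁) (to-≢ u₂) (to-≢ u₃)) (to-near wu) (forth wv)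
      square-at (inj₂ wx) = proj₂ (square px (to-≢ x₁) (to-≢ x₂) (to-≢ x₃)) (to-near wx) (forth wv)

      case-of : D.Near (to w) (to t₁) ⊎ D.Near (to w) (to t₂) ⊎ D.Near v′ (to t₃) → ⊥
      case-of (inj₁ n)        = w₁ (to-near⁻¹ n)
      case-of (inj₂ (inj₁ n)) = w₂ (to-near⁻¹ n)
      case-of (inj₂ (inj₂ n)) = v₃ (back n)

    contra : (Off z t₁ b c × Off z t₂ a c) ⊎ (Off z t₁ a c × Off z t₂ b c) → ⊥
    contra (inj₁ (v₁ , v₂)) = blocked
      (third-not-near o₂ n₁₂ c≢a c≢b d v₁ v₂ o₃ n₁₃ n₂₃)
      (detour-avoiding o₂ n₁₂ c≢a c≢b d v₁ v₂ ou ox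
        (≢-sym u₁) (≢-sym u₂) (≢-sym x₁) (≢-sym x₂) u≢x)
    contra (inj₂ (v₁ , v₂)) = blocked
      (third-not-near (off-swap o₂) n₁₂ c≢b c≢a d v₁ v₂ (off-swap o₃) n₁₃ n₂₃)
      (detour-avoiding (off-swap o₂) n₁₂ c≢b c≢a d v₁ v₂ (off-swap ou) (off-swap ox)
        (≢-sym u₁) (≢-sym u₂) (≢-sym x₁) (≢-sym x₂) u≢x)

  -- If the images formed a star, two further points `s` and `t` of the line would have images in
  -- the star or exceptional. Both in the star contradicts `line-not-star`; one of each kind
  -- contradicts `exceptional-far`, as `s` and `t` are near; two exceptional ones would coincide.
  to-col-distinct : u ≢ v → u ≢ w → v ≢ w → Col u v w → D.Col (to u) (to v) (to w)
  to-col-distinct {u} {v} {w} u≢v u≢w v≢w (a , b , ov , ow)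
    with D.triangle (to-near (off⇒near ov)) (to-near (near-sym (off⇒near ow)))
           (to-near (off⇒near (off-trans (off-sym ow) ov))) (to-≢ u≢v)
  ... | inj₁ col = col
  ... | inj₂ (p , (_ , pu) , (_ , pv) , (_ , pw))
    with fresh (u at a) (v at a) (w at a) (w at a)
  ... | q , qu , qv , qw , _
    with fresh (u at a) (v at a) (w at a) q
  ... | r , ru , rv , rw , rq
    with move u a q b (off-≢ ov u≢v) | move u a r b (off-≢ ov u≢v)
  ... | s , os , sa | t , ot , ta =
    ⊥-elim (split (fourth-of os s≢u s≢v s≢w) (fourth-of ot t≢u t≢v t≢w))
    where
    apart : ∀ {x y z} → x at a ≡ z → z ≢ y at a → x ≢ y
    apart e n refl = n (sym e)
    s≢u = apart sa qu
    s≢v = apart sa qv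
    s≢w = apart sa qw
    t≢u = apart ta ru
    t≢v = apart ta rv
    t≢w = apart ta rw
    s≢t : s ≢ t
    s≢t e = rq (trans (sym ta) (trans (cong (_at a) (sym e)) sa))

    module S = D.Star p
    φu≢φv = to-≢ u≢v
    φu≢φw = to-≢ u≢w
    φv≢φw = to-≢ v≢w

    Exc : D.Word → Set
    Exc = S.Exceptional pu pv pw φu≢φv φu≢φw φv≢φw

    fourth-of : ∀ {x} → Off x u a b → x ≢ u → x ≢ v → x ≢ w →
                ∃ (D.On p (to x)) ⊎ Exc (to x)
    fourth-of ox _ _ _ = S.fourth pu pv pw φu≢φv φu≢φw φv≢φw
      (to-near (off⇒near ox)) (to-near (off⇒near (off-trans ox ov))) (to-near (off⇒near (off-trans ox ow)))

    s-t : Off s t a b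
    s-t = off-trans os (off-sym ot)

    far : ∀ {x y} → Off x y a b → y ≢ u → y ≢ v → y ≢ w →
          Exc (to x) → ¬ ∃ (D.On p (to y))
    far o yu yv yw ex (_ , py) =
      S.exceptional-far pu pv pw φu≢φv φu≢φw φv≢φw ex py (to-≢ yu) (to-≢ yv) (to-≢ yw)
        (to-near (off⇒near o))

    split : ∃ (D.On p (to s)) ⊎ Exc (to s) → ∃ (D.On p (to t)) ⊎ Exc (to t) → ⊥
    split (inj₁ ps) (inj₁ pt) = line-not-star
      (off-trans os ov) (off-trans os ow) os s-t s≢v s≢w v≢w
      (≢-sym s≢u) u≢v u≢w (≢-sym s≢t) t≢v t≢w (≢-sym t≢u)
      (_ , pu) pt ps (_ , pv) (_ , pw)
    split (inj₁ ps) (inj₂ et) = far (off-sym s-t) s≢u s≢v s≢w et ps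
    split (inj₂ es) (inj₁ pt) = far s-t t≢u t≢v t≢w es pt
    split (inj₂ es) (inj₂ et) =
      to-≢ s≢t (S.exceptional-unique pu pv pw φu≢φv φu≢φw φv≢φw es et)

  to-col : u ≢ v → Col u v w → D.Col (to u) (to v) (to w)
  to-col {u} {v} {w} u≢v col@(a , b , ov , ow) with u at a ≟ₛ w at a | v at a ≟ₛ w at a
  ... | yes e | _ with off-extˡ ow e
  ...   | refl with to-near (off⇒near ov)
  ...     | s , t , o = s , t , o , D.off-refl
  to-col {u} {v} {w} u≢v col@(a , b , ov , ow) | no _ | yes e
    with off-extˡ (off-trans (off-sym ov) ow) e
  ... | refl with to-near (off⇒near ov)
  ...   | s , t , o = s , t , o , o
  to-col u≢v col | no u≢w | no v≢w = to-col-distinct u≢v (≢-at u≢w) (≢-at v≢w) col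

  -- The form in which collinearity is used: the image of one further point `v` locates the image of
  -- the whole line through `u`.
  to-off : u ≢ v → Off u v i j → Off u w i j → ∀ {p q} → D.Off (to u) (to v) p q → D.Off (to u) (to w) p q
  to-off u≢v o o′ φo = D.col-pin (to-col u≢v (_ , _ , o , o′)) (to-≢ u≢v) φo

-- Images of the lines and planes through the origin

module Planes {C D : Code} (φ : CodeIso C D)
  (fresh : (a b c d : Code.Symbol C) → ∃ λ (q : Code.Symbol C) → q ≢ a × q ≢ b × q ≢ c × q ≢ d)
  {e : Code.Symbol C} {o : Code.Word C} (o-at : ∀ i → Code._at_ C o i ≡ e)
  {e′ : Code.Symbol D} (φo-at : ∀ i → Code._at_ D (CodeIso.to φ o) i ≡ e′) where

  open Code C
  open CodeProperties C
  open Collineation φ fresh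
  open CodeIso φ
  private
    module D where
      open Code D public
      open CodeProperties D public

    fresh₂ : ∀ a b → ∃ λ q → q ≢ a × q ≢ b
    fresh₂ a b with fresh a b a b
    ... | q , qa , qb , _ = q , qa , qb

  private variable
    v w : Word
    i j k : Pos
    p q r s : D.Pos

  Image : Pos → Pos → D.Pos → D.Pos → Set
  Image i j p q = ∀ v → Off o v i j → D.Off (to o) (to v) p q

  image-swap : Image i j p q → Image j i q p
  image-swap im v ov = D.off-swap (im v (off-swap ov))

  image : v ≢ o → Off o v i j → D.Off (to o) (to v) p q → Image i j p q
  image v≢o ov φv w ow = to-off (≢-sym v≢o) ov ow φv

  φ-at : D.Off (to o) (to v) p q → r ≢ p → r ≢ q → to v D.at r ≡ e′
  φ-at oφ r≢p r≢q = trans (sym (oφ r≢p r≢q)) (φo-at _)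

  φ-at≢ˡ : v ≢ o → D.Off (to o) (to v) p q → to v D.at p ≢ e′
  φ-at≢ˡ v≢o oφ eq = D.off-diffˡ oφ (to-≢ (≢-sym v≢o)) (trans (φo-at _) (sym eq))

  φ-at≢ʳ : v ≢ o → D.Off (to o) (to v) p q → to v D.at q ≢ e′
  φ-at≢ʳ v≢o oφ = φ-at≢ˡ v≢o (D.off-swap oφ)

  at-e : Off o v i j → k ≢ i → k ≢ j → v at k ≡ e
  at-e ov k≢i k≢j = trans (sym (ov k≢i k≢j)) (o-at _)

  at≢ˡ : v ≢ o → Off o v i j → v at i ≢ e
  at≢ˡ v≢o ov eq = off-diffˡ ov (≢-sym v≢o) (trans (o-at _) (sym eq))

  at≢ʳ : v ≢ o → Off o v i j → v at j ≢ e
  at≢ʳ v≢o ov = at≢ˡ v≢o (off-swap ov)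

  at⇒≢o : v at i ≢ e → v ≢ o
  at⇒≢o n refl = n (o-at _)

  pt : ∀ i x j → i ≢ j → ∃ λ v → Off o v i j × v at i ≡ x
  pt i x j i≢j with move o i x j i≢j
  ... | v , ov , vi = v , off-sym ov , vi

  differ : ∀ {v w x y} → v at i ≡ x → w at i ≡ y → x ≢ y → Diff v w i
  differ refl refl x≢y = x≢y

  D-differ : ∀ {v w x y} → v D.at p ≡ x → w D.at p ≡ y → x ≢ y → D.Diff v w p
  D-differ refl refl x≢y = x≢y

  not-near : Off o v i j → v ≢ o → Off o w i k → w ≢ o → j ≢ k → v at i ≢ w at i → ¬ Near v w
  not-near ov v≢o ow w≢o j≢k vi≢wi n = near-diff₃ n
    (off-≢ ov (≢-sym v≢o)) (≢-sym (off-≢ ow (≢-sym w≢o))) (≢-sym j≢k) vi≢wi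
    (differ refl (at-e ow (≢-sym (off-≢ ov (≢-sym v≢o))) j≢k) (at≢ʳ v≢o ov))
    (differ (at-e ov (≢-sym (off-≢ ow (≢-sym w≢o))) (≢-sym j≢k)) refl (≢-sym (at≢ʳ w≢o ow)))

  -- The line of `i` and `j` has a point whose symbol at `i` is neither `e` nor that of `w`. It is
  -- not near `w`, but two images on one line are near.
  image-not-on : Image i j p q → i ≢ j → Off o w i k → w ≢ o → j ≢ k → ¬ D.Off (to o) (to w) p q
  image-not-on {i} {j} {w = w} im i≢j ow w≢o j≢k φw with fresh₂ e (w at i)
  ... | x , x≢e , x≢w with pt i x j i≢j
  ... | v , ov , vi = not-near ov (at⇒≢o (λ z → x≢e (trans (sym vi) z))) ow w≢o j≢k
          (λ z → x≢w (trans (sym vi) z))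
          (to-near⁻¹ (D.off⇒near (D.off-trans (D.off-sym (im _ ov)) φw)))

  -- Points of the two lines with the same symbol at `i` are near. Their images lie on different
  -- lines through the origin by `image-not-on`, and can be near only if these lines share a
  -- position.
  incident-images : i ≢ j → i ≢ k → j ≢ k →
    ∃ λ p → ∃ λ q → ∃ λ r → p ≢ q × p ≢ r × q ≢ r × Image i j p q × Image i k p r
  incident-images {i} {j} {k} i≢j i≢k j≢k with fresh₂ e e
  ... | x , x≢e , _ with pt i x j i≢j | pt i x k i≢k
  ... | A , oA , Ai | B , oB , Bi with to-near (off⇒near oA)
  ... | a , b , φA with D.off? (to B) (to o) a b
  ...   | inj₁ φB = ⊥-elim (image-not-on (image (at⇒≢o (λ z → x≢e (trans (sym Ai) z))) oA φA) i≢j oB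
            (at⇒≢o (λ z → x≢e (trans (sym Bi) z))) j≢k (D.off-sym φB))
  ...   | inj₂ (c , c≢a , c≢b , d) = conclude
          (D.off-line φA (to-≢ (≢-sym A≢o)) (to-near (near-sym (off⇒near oB)))
            (to-near (near-sym (off⇒near (off-through oA oB (trans Ai (sym Bi)))))) c≢a c≢b d)
    where
    A≢o : A ≢ o
    A≢o = at⇒≢o (λ z → x≢e (trans (sym Ai) z))

    B≢o : B ≢ o
    B≢o = at⇒≢o (λ z → x≢e (trans (sym Bi) z))

    a≢b : a ≢ b
    a≢b = D.off-≢ φA (to-≢ (≢-sym A≢o))

    conclude : (D.Off (to B) (to o) b c × D.Off (to B) (to A) a c) ⊎
               (D.Off (to B) (to o) a c × D.Off (to B) (to A) b c) → _
    conclude (inj₁ (φB , _)) = b , a , c , ≢-sym a≢b , ≢-sym c≢b , ≢-sym c≢a ,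
      image A≢o oA (D.off-swap φA) , image B≢o oB (D.off-sym φB)
    conclude (inj₂ (φB , _)) = a , b , c , a≢b , ≢-sym c≢a , ≢-sym c≢b ,
      image A≢o oA φA , image B≢o oB (D.off-sym φB)

  module _ (i≢j : i ≢ j) (i≢k : i ≢ k) (j≢k : j ≢ k)
           (p≢q : p ≢ q) (p≢r : p ≢ r) (q≢r : q ≢ r)
           (im-ij : Image i j p q) (im-ik : Image i k p r) where

    private
      -- The images are near and differ at `q`, where only the first is nontrivial, and at `r`,
      -- where only the second is. So they agree at `p`.
      joint : ∀ {A B} → Off o A i j → A ≢ o → Off o B i k → B ≢ o →
              A at i ≡ B at i → D.Off (to A) (to B) q r
      joint oA A≢o oB B≢o e = D.near-diff₂
        (to-near (off⇒near (off-through oA oB e))) q≢r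
        (D-differ refl (φ-at (im-ik _ oB) (≢-sym p≢q) q≢r) (φ-at≢ʳ A≢o (im-ij _ oA)))
        (D-differ (φ-at (im-ij _ oA) (≢-sym p≢r) (≢-sym q≢r)) refl (≢-sym (φ-at≢ʳ B≢o (im-ik _ oB))))

    private
      module Third {C : Word} (oC : Off o C j k) (C≢o : C ≢ o) where
        -- If the image of `C` were trivial at `q` too, it would differ from the image of `A` at `p`
        -- and `q` only. It would then lie on the same line through the origin, with a trivial
        -- symbol at `p`, and `C` would be `o`.
        φC-q≢ : ∀ {A q} → D.Off (to o) (to A) p q → A ≢ o → Near C A → p ≢ q →
                to C D.at p ≡ e′ → D.Diff (to o) (to C) q
        φC-q≢ {A} {q} φA A≢o CA p≢q Cp Cq
          with D.near-diff (to-near CA) (D-differ Cp refl (≢-sym (φ-at≢ˡ A≢o φA)))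
        ... | s , o-CA with D.off-pin o-CA (≢-sym p≢q)
                              (D-differ (trans (sym Cq) (φo-at _)) refl (≢-sym (φ-at≢ʳ A≢o φA)))
        ...   | refl = to-≢ C≢o
                (D.off-extˡ (D.off-trans o-CA (D.off-sym φA)) (trans Cp (sym (φo-at _))))

        -- If the images of the three lines had only p in common, the image of a
        -- generic word of the plane would be a neighbour of the origin.
        no-fan : ∀ {s} → s ≢ q → s ≢ r → D.Off (to o) (to C) p s → ⊥
        no-fan {s} s≢q s≢r φC with pt j (C at j) i (≢-sym i≢j)
        -- `P` will lie both on the line of `A` and `C` and on that of `A₂` and `B₂`. The choice
        -- `x ≢ A at i` separates `P` from `A`, which makes `P` nontrivial at `k`.
        ... | A , oA , Aj with fresh₂ e (A at i)
        ... | x , x≢e , x≢A with move C i x k i≢k | pt i x j i≢j | pt i x k i≢k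
        ... | P , oP , Pi | A₂ , oA₂ , A₂i | B₂ , oB₂ , B₂i =
          near-diff₃ P-o i≢j (≢-sym i≢k) (≢-sym j≢k)
            (differ Pi (o-at _) x≢e) (differ Pj (o-at _) (at≢ˡ C≢o oC))
            (differ refl (o-at _) Pk)
          where
          A≢o : A ≢ o
          A≢o = at⇒≢o λ z → at≢ˡ C≢o oC (trans (sym Aj) z)

          A₂≢o : A₂ ≢ o
          A₂≢o = at⇒≢o λ z → x≢e (trans (sym A₂i) z)

          B₂≢o : B₂ ≢ o
          B₂≢o = at⇒≢o λ z → x≢e (trans (sym B₂i) z)

          Pj : P at j ≡ C at j
          Pj = oP (≢-sym i≢j) j≢k

          A-C : Off A C i k
          A-C = off-through oA oC Aj

          φA : D.Off (to o) (to A) p q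
          φA = im-ij _ (off-swap oA)

          φA-C : D.Off (to A) (to C) q s
          φA-C = D.near-diff₂ (to-near (off⇒near A-C)) (≢-sym s≢q)
            (D-differ refl (φ-at φC (≢-sym p≢q) (≢-sym s≢q)) (φ-at≢ʳ A≢o φA))
            (D-differ (φ-at φA (≢-sym (D.off-≢ φC (to-≢ (≢-sym C≢o)))) s≢q) refl
              (≢-sym (φ-at≢ʳ C≢o φC)))

          A≢C : A ≢ C
          A≢C A≡C = at≢ʳ A≢o oA (trans (cong (_at i) A≡C) (at-e oC i≢j i≢k))

          φA-P : D.Off (to A) (to P) q s
          φA-P = to-off A≢C A-C (off-trans A-C (off-sym oP)) φA-C

          A₂-B₂ : Off A₂ B₂ j k
          A₂-B₂ = off-through oA₂ oB₂ (trans A₂i (sym B₂i))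

          A₂-P : Off A₂ P j k
          A₂-P {l} l≢j l≢k with l ≟ i
          ... | yes refl = trans A₂i (sym Pi)
          ... | no l≢i   = trans (at-e oA₂ l≢i l≢j) (sym (trans (oP l≢i l≢k) (at-e oC l≢j l≢k)))

          A₂≢B₂ : A₂ ≢ B₂
          A₂≢B₂ eq = at≢ʳ A₂≢o oA₂ (trans (cong (_at j) eq) (at-e oB₂ (≢-sym i≢j) j≢k))

          φA₂-P : D.Off (to A₂) (to P) q r
          φA₂-P = to-off A₂≢B₂ A₂-B₂ A₂-P (joint oA₂ A₂≢o oB₂ B₂≢o (trans A₂i (sym B₂i)))

          φP : D.Off (to P) (to o) p q
          -- The comparison with the image of `A` covers `r`, because `s ≢ r`; the comparison with
          -- the image of `A₂` covers the rest.
          φP {l} l≢p l≢q with l ≟ r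
          ... | yes refl = trans (sym (φA-P l≢q (≢-sym s≢r))) (sym (im-ij _ (off-swap oA) l≢p l≢q))
          ... | no l≢r   = trans (sym (φA₂-P l≢q l≢r)) (sym (im-ij _ oA₂ l≢p l≢q))

          P-o : Near P o
          P-o = to-near⁻¹ (D.off⇒near φP)

          Pk : P at k ≢ e
          Pk eq = x≢A (trans (sym Pi) (sym (cong (_at i) A≡P)))
            where
            A≡P : A ≡ P
            A≡P = off-extʳ (off-trans A-C (off-sym oP))
                    (trans (at-e oA (≢-sym j≢k) (≢-sym i≢k)) (sym eq))

        -- A nontrivial symbol at `p` would place the image of `C` on a line with positions `p` and
        -- some `s`. If `s` is `q` or `r`, this contradicts `image-not-on`; any other `s` gives a
        -- fan.
        third : D.Off (to o) (to C) q r
        third with pt j (C at j) i (≢-sym i≢j) | pt k (C at k) i (≢-sym i≢k)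
        ... | A , oA , Aj | B , oB , Bk with to C D.at p D.≟ₛ e′
        ...   | yes Cp = D.near-diff₂ (to-near (off⇒near oC)) q≢r
                  (φC-q≢ (im-ij _ (off-swap oA)) (at⇒≢o λ z → at≢ˡ C≢o oC (trans (sym Aj) z))
                    (off⇒near (off-through oC oA (sym Aj))) p≢q Cp)
                  (φC-q≢ (im-ik _ (off-swap oB)) (at⇒≢o λ z → at≢ʳ C≢o oC (trans (sym Bk) z))
                    (off⇒near (off-through (off-swap oC) oB (sym Bk))) p≢r Cp)
        ...   | no Cp with D.near-diff (to-near (off⇒near oC)) (D-differ (φo-at _) refl (≢-sym Cp))
        ...     | s , φC with s ≟ q | s ≟ r
        ...       | yes refl | _ = ⊥-elim
                    (image-not-on (image-swap im-ij) (≢-sym i≢j) oC C≢o i≢k (D.off-swap φC))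
        ...       | no _ | yes refl = ⊥-elim
                    (image-not-on (image-swap im-ik) (≢-sym i≢k) (off-swap oC) C≢o i≢j (D.off-swap φC))
        ...       | no s≢q | no s≢r = ⊥-elim (no-fan s≢q s≢r φC)

    third-image : Image j k q r
    third-image C oC with C at j ≟ₛ e
    ... | no Cj = Third.third oC (at⇒≢o Cj)
    ... | yes Cj with off-extˡ oC (trans (o-at _) (sym Cj))
    ...   | refl = D.off-refl

    -- If `v at i` is nontrivial, then `v`, `b` and the point `A` of the line of `i` and `j` with
    -- the same symbol at `i` are collinear. By `joint` the image of their line varies at `q` and
    -- `r` only, so the symbol at `p` depends on the symbol at `i` alone.
    plane-image : ∀ {v b} → Image j k q r →
                  (∀ {l} → l ≢ i → l ≢ j → l ≢ k → v at l ≡ e) →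
                  Off o b i k → b at i ≡ v at i →
                  to v D.at p ≡ to b D.at p ×
                  (∀ {l} → l ≢ p → l ≢ q → l ≢ r → to v D.at l ≡ e′)
    plane-image {v} {b} im-jk plane ob bi with v at i ≟ₛ e
    ... | yes vi = trans (φ-at φv p≢q p≢r) (sym (trans (cong (λ z → to z D.at p) (sym o≡b)) (φo-at _))) ,
                   λ _ l≢q l≢r → φ-at φv l≢q l≢r
      where
      o≡b : o ≡ b
      o≡b = off-extˡ ob (trans (o-at _) (sym (trans bi vi)))

      ov : Off o v j k
      ov {l} l≢j l≢k with l ≟ i
      ... | yes refl = trans (o-at _) (sym vi)
      ... | no l≢i   = trans (o-at _) (sym (plane l≢i l≢j l≢k))

      φv : D.Off (to o) (to v) q r
      φv = im-jk _ ov
    ... | no vi with pt i (v at i) j i≢j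
    ...   | A , oA , Ai = sym (φb-v p≢q p≢r) ,
                          λ l≢p l≢q l≢r → trans (sym (φb-v l≢q l≢r)) (φ-at (im-ik _ ob) l≢p l≢r)
      where
      A≢o : A ≢ o
      A≢o = at⇒≢o λ z → vi (trans (sym Ai) z)

      b≢o : b ≢ o
      b≢o = at⇒≢o λ z → vi (trans (sym bi) z)

      A-b : Off A b j k
      A-b = off-through oA ob (trans Ai (sym bi))

      A-v : Off A v j k
      A-v {l} l≢j l≢k with l ≟ i
      ... | yes refl = Ai
      ... | no l≢i   = trans (at-e oA l≢i l≢j) (sym (plane l≢i l≢j l≢k))

      A≢b : A ≢ b
      A≢b eq = at≢ʳ A≢o oA (trans (cong (_at j) eq) (at-e ob (≢-sym i≢j) j≢k))

      φA-b : D.Off (to A) (to b) q r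
      φA-b = joint oA A≢o ob b≢o (trans Ai (sym bi))

      φb-v : D.Off (to b) (to v) q r
      φb-v = D.off-trans (D.off-sym φA-b) (to-off A≢b A-b A-v φA-b)

  -- `plane-image` applies to `i`, `j` and `k` in turn, so the three coordinates of an image
  -- separate. The maps `f`, `g`, `h` are read off on the three lines through the origin.
  plane-isotopy : i ≢ j → i ≢ k → j ≢ k →
    ∃ λ p → ∃ λ q → ∃ λ r → p ≢ q × p ≢ r × q ≢ r ×
    ∃ λ (f : Symbol → D.Symbol) → ∃ λ (g : Symbol → D.Symbol) → ∃ λ (h : Symbol → D.Symbol) →
      (∀ {x y} → f x ≡ f y → x ≡ y) ×
      (∀ {v} → (∀ {l} → l ≢ i → l ≢ j → l ≢ k → v at l ≡ e) →
        to v D.at p ≡ f (v at i) × to v D.at q ≡ g (v at j) × to v D.at r ≡ h (v at k) ×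
        (∀ {l} → l ≢ p → l ≢ q → l ≢ r → to v D.at l ≡ e′))
  plane-isotopy {i} {j} {k} i≢j i≢k j≢k with incident-images i≢j i≢k j≢k
  ... | p , q , r , p≢q , p≢r , q≢r , im-ij , im-ik =
    p , q , r , p≢q , p≢r , q≢r , f , g , h , f-injective , coordinates
    where
    j≢i = ≢-sym i≢j
    k≢i = ≢-sym i≢k
    k≢j = ≢-sym j≢k

    im-jk : Image j k q r
    im-jk = third-image i≢j i≢k j≢k p≢q p≢r q≢r im-ij im-ik

    on-ik : ∀ x → ∃ λ v → Off o v i k × v at i ≡ x
    on-ik x = pt i x k i≢k
    on-ji : ∀ y → ∃ λ v → Off o v j i × v at j ≡ y
    on-ji y = pt j y i j≢i
    on-kj : ∀ z → ∃ λ v → Off o v k j × v at k ≡ z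
    on-kj z = pt k z j k≢j

    f g h : Symbol → D.Symbol
    f x = to (proj₁ (on-ik x)) D.at p
    g y = to (proj₁ (on-ji y)) D.at q
    h z = to (proj₁ (on-kj z)) D.at r

    f-injective : ∀ {x y} → f x ≡ f y → x ≡ y
    f-injective {x} {y} eq =
      trans (sym (proj₂ (proj₂ (on-ik x))))
        (trans (cong (_at i) (injective (D.off-extˡ
          (D.off-trans (D.off-sym (φ-on-ik x)) (φ-on-ik y)) eq)))
        (proj₂ (proj₂ (on-ik y))))
      where
      φ-on-ik : ∀ x → D.Off (to o) (to (proj₁ (on-ik x))) p r
      φ-on-ik x = im-ik _ (proj₁ (proj₂ (on-ik x)))

    coordinates : ∀ {v} → (∀ {l} → l ≢ i → l ≢ j → l ≢ k → v at l ≡ e) →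
      to v D.at p ≡ f (v at i) × to v D.at q ≡ g (v at j) × to v D.at r ≡ h (v at k) ×
      (∀ {l} → l ≢ p → l ≢ q → l ≢ r → to v D.at l ≡ e′)
    coordinates {v} plane = proj₁ at-i , proj₁ at-j , proj₁ at-k , proj₂ at-i
      where
      at-i = let (a , oa , ai) = on-ik (v at i) in
        plane-image i≢j i≢k j≢k p≢q p≢r q≢r im-ij im-ik im-jk plane oa ai
      at-j = let (b , ob , bj) = on-ji (v at j) in
        plane-image j≢k j≢i k≢i q≢r (≢-sym p≢q) (≢-sym p≢r)
          im-jk (image-swap im-ij) (image-swap im-ik)
          (λ l≢j l≢k l≢i → plane l≢i l≢j l≢k) ob bj
      at-k = let (c , oc , ck) = on-kj (v at k) in
        plane-image k≢i k≢j i≢j (≢-sym p≢r) (≢-sym q≢r) p≢q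
          (image-swap im-ik) (image-swap im-jk) im-ij
          (λ l≢k l≢i l≢j → plane l≢i l≢j l≢k) oc ck

-- The words of a direct power

module Elements (G : FiniteGroup) where
  group : Group 0ℓ 0ℓ
  group = record { isGroup = isGroup G }

  open Group group public
    using (assoc; identityˡ; identityʳ; inverseˡ; inverseʳ)
    renaming (Carrier to Element; _∙_ to infixl 7 _·_; ε to 𝟙; _⁻¹ to infix 8 _⁻)
  open GroupProperties group public
    using (∙-cancelˡ; ∙-cancelʳ; ε⁻¹≈ε; inverseˡ-unique; inverseʳ-unique; ⁻¹-involutive;
           ⁻¹-injective; ⁻¹-anti-homo-∙)

  index : Element → Fin (size G)
  index = Inverse.to (finite G)

  index-injective : ∀ {x y} → index x ≡ index y → x ≡ y
  index-injective e = trans (sym (Inverse.strictlyInverseʳ (finite G) _))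
    (trans (cong (Inverse.from (finite G)) e) (Inverse.strictlyInverseʳ (finite G) _))

  infix 4 _≟ᵉ_
  _≟ᵉ_ : DecidableEquality Element
  x ≟ᵉ y = map′ index-injective (cong index) (index x ≟ index y)

  cancel-inverseˡ : ∀ x y → x ⁻ · (x · y) ≡ y
  cancel-inverseˡ x y = trans (sym (assoc _ _ _)) (trans (cong (_· y) (inverseˡ x)) (identityˡ y))

  cancel-inverseʳ : ∀ x y → x · (x ⁻ · y) ≡ y
  cancel-inverseʳ x y = trans (sym (assoc _ _ _)) (trans (cong (_· y) (inverseʳ x)) (identityˡ y))

  rotate : ∀ {x y z} → x · y · z ≡ 𝟙 → y · z · x ≡ 𝟙
  rotate {x} {y} {z} e = trans
    (cong (y · z ·_) (inverseˡ-unique x (y · z) (trans (sym (assoc _ _ _)) e)))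
    (inverseʳ (y · z))

  prod : ∀ {n} → (Fin n → Element) → Element
  prod {zero}  w = 𝟙
  prod {suc n} w = w zero · prod (w ∘ suc)

  private variable
    m n : ℕ

  prod-cong : {w w′ : Fin n → Element} → (∀ i → w i ≡ w′ i) → prod w ≡ prod w′
  prod-cong {zero}  e = refl
  prod-cong {suc n} e = cong₂ _·_ (e zero) (prod-cong (e ∘ suc))

  prod-determines : {w w′ : Fin n → Element} (j : Fin n) →
    (∀ i → i ≢ j → w i ≡ w′ i) → prod w ≡ prod w′ → w j ≡ w′ j
  prod-determines {suc n} {w} {w′} zero e p =
    ∙-cancelʳ (prod (w ∘ suc)) _ _
      (trans p (cong (w′ zero ·_) (sym (prod-cong λ i → e (suc i) λ ()))))
  prod-determines {suc n} {w} {w′} (suc j) e p =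
    prod-determines j (λ i i≢j → e (suc i) (i≢j ∘ Fin.suc-injective))
      (∙-cancelˡ (w zero) _ _ (trans p (cong (_· _) (sym (e zero λ ())))))

  prod-solve : (w : Fin n → Element) (j : Fin n) (t : Element) →
    ∃ λ w′ → (∀ i → i ≢ j → w′ i ≡ w i) × prod w′ ≡ t
  prod-solve {suc n} w zero t = w′ , agree ,
    trans (assoc _ _ _) (trans (cong (t ·_) (inverseˡ _)) (identityʳ t))
    where
    w′ : Fin (suc n) → Element
    w′ zero    = t · prod (w ∘ suc) ⁻
    w′ (suc i) = w (suc i)
    agree : ∀ i → i ≢ zero → w′ i ≡ w i
    agree zero 0≢0  = ⊥-elim (0≢0 refl)
    agree (suc i) _ = refl
  prod-solve {suc n} w (suc j) t with prod-solve (w ∘ suc) j (w zero ⁻ · t)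
  ... | v , v≡ , p = w′ , agree , trans (cong (w zero ·_) p) (cancel-inverseʳ _ _)
    where
    w′ : Fin (suc n) → Element
    w′ zero    = w zero
    w′ (suc i) = v i
    agree : ∀ i → i ≢ suc j → w′ i ≡ w i
    agree zero _      = refl
    agree (suc i) i≢j = v≡ i (i≢j ∘ cong suc)

  prod₀ : {w : Fin n → Element} → (∀ i → w i ≡ 𝟙) → prod w ≡ 𝟙
  prod₀ {zero}  e = refl
  prod₀ {suc n} e = trans (cong₂ _·_ (e zero) (prod₀ (e ∘ suc))) (identityˡ 𝟙)

  prod₁ : {w : Fin n → Element} (i : Fin n) → (∀ l → l ≢ i → w l ≡ 𝟙) → prod w ≡ w i
  prod₁ zero e = trans (cong (_ ·_) (prod₀ λ l → e (suc l) λ ())) (identityʳ _)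
  prod₁ (suc i) e = trans (cong₂ _·_ (e zero λ ()) (prod₁ i λ l l≢ → e (suc l) (l≢ ∘ Fin.suc-injective)))
    (identityˡ _)

  prod₂ : {w : Fin n → Element} (i j : Fin n) → i Fin.< j →
    (∀ l → l ≢ i → l ≢ j → w l ≡ 𝟙) → prod w ≡ w i · w j
  prod₂ zero (suc j) _ e = cong (_ ·_) (prod₁ j λ l l≢ → e (suc l) (λ ()) (l≢ ∘ Fin.suc-injective))
  prod₂ (suc i) (suc j) (s≤s i<j) e = trans
    (cong₂ _·_ (e zero (λ ()) λ ())
      (prod₂ i j i<j λ l l≢i l≢j → e (suc l) (l≢i ∘ Fin.suc-injective) (l≢j ∘ Fin.suc-injective)))
    (identityˡ _)

  prod₃ : {w : Fin n → Element} (i j k : Fin n) → i Fin.< j → j Fin.< k →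
    (∀ l → l ≢ i → l ≢ j → l ≢ k → w l ≡ 𝟙) → prod w ≡ w i · w j · w k
  prod₃ zero (suc j) (suc k) _ (s≤s j<k) e = trans
    (cong (_ ·_) (prod₂ j k j<k λ l l≢j l≢k →
      e (suc l) (λ ()) (l≢j ∘ Fin.suc-injective) (l≢k ∘ Fin.suc-injective)))
    (sym (assoc _ _ _))
  prod₃ (suc i) (suc j) (suc k) (s≤s i<j) (s≤s j<k) e = trans
    (cong₂ _·_ (e zero (λ ()) (λ ()) λ ())
      (prod₃ i j k i<j j<k λ l l≢i l≢j l≢k →
        e (suc l) (l≢i ∘ Fin.suc-injective) (l≢j ∘ Fin.suc-injective) (l≢k ∘ Fin.suc-injective)))
    (identityˡ _)

  -- Here `y` is the entry that precedes the vector. It is `𝟙` for the words of the code; the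
  -- general case serves the recursion.
  coords : Element → Vec Element m → Fin (suc m) → Element
  coords y []       zero    = y ⁻
  coords y (x ∷ xs) zero    = y ⁻ · x
  coords y (x ∷ xs) (suc i) = coords x xs i

  prod-coords : ∀ y (xs : Vec Element m) → prod (coords y xs) ≡ y ⁻
  prod-coords y []       = identityʳ _
  prod-coords y (x ∷ xs) = trans (cong (y ⁻ · x ·_) (prod-coords x xs))
    (trans (assoc _ _ _) (trans (cong (y ⁻ ·_) (inverseʳ x)) (identityʳ _)))

  coords-injective : ∀ y (xs zs : Vec Element m) →
    (∀ i → coords y xs i ≡ coords y zs i) → xs ≡ zs
  coords-injective y [] [] e = refl
  coords-injective y (x ∷ xs) (z ∷ zs) e with ∙-cancelˡ (y ⁻) x z (e zero)
  ... | refl = cong (x ∷_) (coords-injective x xs zs (e ∘ suc))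

  coords-surjective : ∀ y (w : Fin (suc m) → Element) → prod w ≡ y ⁻ →
    ∃ λ xs → ∀ i → coords y xs i ≡ w i
  coords-surjective {zero}  y w p = [] , λ { zero → trans (sym p) (identityʳ _) }
  coords-surjective {suc m} y w p with coords-surjective (y · w zero) (w ∘ suc)
    (inverseʳ-unique _ _ (trans (assoc _ _ _) (trans (cong (y ·_) p) (inverseʳ y))))
  ... | xs , e = y · w zero ∷ xs , λ { zero → cancel-inverseˡ _ _ ; (suc i) → e i }

  coords-replicate : ∀ m (i : Fin (suc m)) → coords 𝟙 (replicate m 𝟙) i ≡ 𝟙
  coords-replicate zero    zero    = ε⁻¹≈ε
  coords-replicate (suc m) zero    = inverseˡ 𝟙
  coords-replicate (suc m) (suc i) = coords-replicate m i

  code : ℕ → Code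
  code m = record
    { Symbol = Element
    ; Word   = Vec Element m
    ; len    = suc m
    ; _at_   = coords 𝟙
    ; _≟ₛ_   = _≟ᵉ_
    ; ext    = ext
    ; move   = move
    }
    where
    ext : ∀ {u v : Vec Element m} {j} →
          (∀ {i} → i ≢ j → coords 𝟙 u i ≡ coords 𝟙 v i) → u ≡ v
    ext {u} {v} {j} e = coords-injective 𝟙 u v agree
      where
      agree : ∀ i → coords 𝟙 u i ≡ coords 𝟙 v i
      agree i with i ≟ j
      ... | yes refl = prod-determines i (λ _ → e) (trans (prod-coords 𝟙 u) (sym (prod-coords 𝟙 v)))
      ... | no i≢j   = e i≢j

    move : ∀ u i x j → i ≢ j →
           ∃ λ w → (∀ {k} → k ≢ i → k ≢ j → coords 𝟙 w k ≡ coords 𝟙 u k) × coords 𝟙 w i ≡ x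
    -- Setting the symbol at `i` spoils the product, which is then restored at `j`.
    move u i x j i≢j with prod-solve (updateAt (coords 𝟙 u) i (const x)) j (𝟙 ⁻)
    ... | w , w≡ , p with coords-surjective 𝟙 w p
    ...   | xs , e = xs ,
      (λ {k} k≢i k≢j → trans (trans (e k) (w≡ k k≢j)) (updateAt-minimal k i (coords 𝟙 u) k≢i)) ,
      trans (trans (e i) (w≡ i i≢j)) (updateAt-updates i (coords 𝟙 u))

  -- Adjacency of vertices and differences of words

  module _ (x : Element) where
    -- A form of `intervalElem` suited to induction along the vector.
    interval : ∀ {m} → ℕ → ℕ → Vec Element m
    interval {zero}  _       _       = []
    interval {suc m} zero    zero    = 𝟙 ∷ interval zero zero
    interval {suc m} zero    (suc l) = x ∷ interval zero l
    interval {suc m} (suc k) zero    = 𝟙 ∷ interval k zero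
    interval {suc m} (suc k) (suc l) = 𝟙 ∷ interval k l

    intervalElem≡interval : ∀ m k l → intervalElem G m x k l ≡ interval k l
    intervalElem≡interval zero    _       _       = refl
    intervalElem≡interval (suc m) zero    zero    = cong (𝟙 ∷_) (intervalElem≡interval m zero zero)
    intervalElem≡interval (suc m) zero    (suc l) = cong (x ∷_) (intervalElem≡interval m zero l)
    -- One more split on `k` lets the test `k ≤? toℕ j` compute.
    intervalElem≡interval (suc m) (suc zero)    zero    = cong (𝟙 ∷_) (intervalElem≡interval m zero zero)
    intervalElem≡interval (suc m) (suc (suc k)) zero    = cong (𝟙 ∷_) (intervalElem≡interval m (suc k) zero)
    intervalElem≡interval (suc m) (suc zero)    (suc l) = cong (𝟙 ∷_) (intervalElem≡interval m zero l)
    intervalElem≡interval (suc m) (suc (suc k)) (suc l) = cong (𝟙 ∷_) (intervalElem≡interval m (suc k) l)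

    shift : ∀ {m} → ℕ → ℕ → Vec Element m → Vec Element m
    shift k l = zipWith _·_ (interval k l)

    shift-empty : ∀ k (g : Vec Element m) → shift k 0 g ≡ g
    shift-empty _       []      = refl
    shift-empty zero    (z ∷ g) = cong₂ _∷_ (identityˡ z) (shift-empty zero g)
    shift-empty (suc k) (z ∷ g) = cong₂ _∷_ (identityˡ z) (shift-empty k g)

    -- Inside the interval the preceding entry has been multiplied by `x` as well, hence `x · y`.
    -- The common left factor cancels in each quotient until the interval ends at `l`.
    shift-coords₀ : ∀ l y (g : Vec Element m) → l ℕ.≤ m →
      ∀ i → toℕ i ≢ l → coords (x · y) (shift 0 l g) i ≡ coords y g i
    shift-coords₀ zero    y g       _         zero    i≢l = ⊥-elim (i≢l refl)
    shift-coords₀ zero    y (z ∷ g) _         (suc i) _   =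
      cong₂ (λ z g → coords z g i) (identityˡ z) (shift-empty 0 g)
    shift-coords₀ (suc l) y (z ∷ g) _         zero    _   = begin
      (x · y) ⁻ · (x · z)    ≡⟨ cong (_· _) (⁻¹-anti-homo-∙ x y) ⟩
      y ⁻ · x ⁻ · (x · z)    ≡⟨ assoc _ _ _ ⟩
      y ⁻ · (x ⁻ · (x · z))  ≡⟨ cong (y ⁻ ·_) (cancel-inverseˡ x z) ⟩
      y ⁻ · z                ∎
      where open ≡-Reasoning
    shift-coords₀ (suc l) y (z ∷ g) (s≤s l≤m) (suc i) i≢l = shift-coords₀ l z g l≤m i (i≢l ∘ cong suc)

    shift-coords : ∀ k l y (g : Vec Element m) → k ℕ.< l → l ℕ.≤ m →
      ∀ i → toℕ i ≢ k → toℕ i ≢ l → coords y (shift k l g) i ≡ coords y g i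
    shift-coords zero _ y g _ _ zero i≢k _ = ⊥-elim (i≢k refl)
    shift-coords zero (suc l) y (z ∷ g) _ (s≤s l≤m) (suc i) _ i≢l =
      shift-coords₀ l z g l≤m i (i≢l ∘ cong suc)
    shift-coords (suc k) (suc l) y (z ∷ g) _ _ zero _ _ = cong (y ⁻ ·_) (identityˡ z)
    shift-coords (suc k) (suc l) y (z ∷ g) (s≤s k<l) (s≤s l≤m) (suc i) i≢k i≢l =
      trans (cong (λ z → coords z (shift k l g) i) (identityˡ z))
        (shift-coords k l z g k<l l≤m i (i≢k ∘ cong suc) (i≢l ∘ cong suc))

    coords-shift₀ : ∀ l y (g h : Vec Element m) → l ℕ.≤ m →
      (∀ i → toℕ i ≢ l → coords (x · y) h i ≡ coords y g i) → h ≡ shift 0 l g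
    coords-shift₀ _ y [] [] _ _ = refl
    -- The interval has ended and only the present quotient is unknown. The later quotients multiply
    -- to the inverse of the present entry and so determine it.
    coords-shift₀ zero y (z ∷ g) (z′ ∷ h) _ e
      with ⁻¹-injective (trans (sym (prod-coords z′ h))
             (trans (prod-cong λ i → e (suc i) λ ()) (prod-coords z g)))
    ... | refl = trans (cong (z ∷_) (coords-injective z h g λ i → e (suc i) λ ()))
                   (sym (shift-empty 0 (z ∷ g)))
    coords-shift₀ (suc l) y (z ∷ g) (z′ ∷ h) (s≤s l≤m) e
      with ∙-cancelˡ ((x · y) ⁻) z′ (x · z)
             (trans (e zero λ ()) (sym (shift-coords₀ (suc l) y (z ∷ g) (s≤s l≤m) zero λ ())))
    ... | refl = cong (x · z ∷_)
                   (coords-shift₀ l z g h l≤m λ i i≢l → e (suc i) (i≢l ∘ ℕ.suc-injective))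

  -- Entries agree up to position `k`. The entry there reveals the factor `x`, and `coords-shift₀`
  -- carries it on to `l`.
  coords-shift : ∀ k l y (g h : Vec Element m) → k ℕ.< l → l ℕ.≤ m →
    (∀ i → toℕ i ≢ k → toℕ i ≢ l → coords y h i ≡ coords y g i) →
    ∃ λ x → h ≡ shift x k l g
  coords-shift zero (suc l) y (z ∷ g) (z′ ∷ h) _ (s≤s l≤m) e = x , cong₂ _∷_ (sym xz)
      (coords-shift₀ x l z g h l≤m λ i i≢l →
        trans (cong (λ z → coords z h i) xz) (e (suc i) (λ ()) (i≢l ∘ ℕ.suc-injective)))
    where
    x : Element
    x = z′ · z ⁻
    xz : x · z ≡ z′
    xz = trans (assoc _ _ _) (trans (cong (z′ ·_) (inverseˡ z)) (identityʳ z′))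
  coords-shift (suc k) (suc l) y (z ∷ g) (z′ ∷ h) (s≤s k<l) (s≤s l≤m) e
    with ∙-cancelˡ (y ⁻) z′ z (e zero (λ ()) λ ())
  ... | refl with coords-shift k l z g h k<l l≤m
                    (λ i i≢k i≢l → e (suc i) (i≢k ∘ ℕ.suc-injective) (i≢l ∘ ℕ.suc-injective))
  ...   | x , h≡ = x , cong₂ _∷_ (sym (identityˡ z)) h≡

  shift-𝟙 : ∀ k l (g : Vec Element m) → shift 𝟙 k l g ≡ g
  shift-𝟙 _       _       []      = refl
  shift-𝟙 zero    zero    (z ∷ g) = cong₂ _∷_ (identityˡ z) (shift-𝟙 zero zero g)
  shift-𝟙 zero    (suc l) (z ∷ g) = cong₂ _∷_ (identityˡ z) (shift-𝟙 zero l g)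
  shift-𝟙 (suc k) zero    (z ∷ g) = cong₂ _∷_ (identityˡ z) (shift-𝟙 k zero g)
  shift-𝟙 (suc k) (suc l) (z ∷ g) = cong₂ _∷_ (identityˡ z) (shift-𝟙 k l g)

  adj⇒near : ∀ {g h : Vec Element m} → Adj G m g h → Code.Near (code m) g h
  adj⇒near {m} {g} (_ , (x , k , l , _ , k<l , l≤m , refl) , refl) =
    fromℕ< (ℕ.<-trans k<l (s≤s l≤m)) , fromℕ< (s≤s l≤m) , λ {i} i≢k i≢l → sym
      (trans (cong (λ s → coords 𝟙 (zipWith _·_ s g) i) (intervalElem≡interval x m k l))
        (shift-coords x k l 𝟙 g k<l l≤m i
          (λ e → i≢k (Fin.toℕ-injective (trans e (sym (Fin.toℕ-fromℕ< _)))))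
          (λ e → i≢l (Fin.toℕ-injective (trans e (sym (Fin.toℕ-fromℕ< _)))))))

  off⇒adj : ∀ {g h : Vec Element m} {a b} → a Fin.< b → Code.Off (code m) g h a b → g ≢ h → Adj G m g h
  off⇒adj {m} {g} {h} {a} {b} a<b o g≢h
    with coords-shift (toℕ a) (toℕ b) 𝟙 g h a<b (Fin.toℕ≤pred[n] b)
           (λ i i≢a i≢b → sym (o (i≢a ∘ cong toℕ) (i≢b ∘ cong toℕ)))
  ... | x , h≡ = _ ,
    (x , toℕ a , toℕ b , (λ { refl → g≢h (sym (trans h≡ (shift-𝟙 (toℕ a) (toℕ b) g))) }) ,
      a<b , Fin.toℕ≤pred[n] b , sym (intervalElem≡interval x m (toℕ a) (toℕ b))) , h≡

  near⇒adj : ∀ {g h : Vec Element m} → Code.Near (code m) g h → g ≢ h → Adj G m g h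
  near⇒adj {m} (a , b , o) g≢h with Fin.<-cmp a b
  ... | tri< a<b _ _ = off⇒adj a<b o g≢h
  ... | tri≈ _ refl _ = ⊥-elim (g≢h (Code.ext (code m) λ i≢a → o i≢a i≢a))
  ... | tri> _ _ b<a = off⇒adj b<a (λ i≢b i≢a → o i≢a i≢b) g≢h

-- Common neighbours of an edge at the origin

module CommonNeighbours (C : Code)
  {𝐨 : Code.Word C} {𝟙 : Code.Symbol C} (𝐨-at : ∀ i → Code._at_ C 𝐨 i ≡ 𝟙)
  (inv : Code.Symbol C → Code.Symbol C) (inv-involutive : ∀ x → inv (inv x) ≡ x)
  (support₂ : ∀ {v i j} → Code.Off C 𝐨 v i j → i ≢ j → Code._at_ C v j ≡ inv (Code._at_ C v i))
  {A : Code.Word C} {a b : Code.Pos C} (oA : Code.Off C 𝐨 A a b) (A≢𝐨 : A ≢ 𝐨) where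

  open Code C
  open CodeProperties C

  Common : Word → Set
  Common z = Near z 𝐨 × Near z A × z ≢ 𝐨 × z ≢ A

  -- A path of at most two edges among the common neighbours (`Near` admits equality), which stands
  -- in for lying in the same component.
  Linked : Word → Word → Set
  Linked z z′ = ∃ λ y → Common y × Near z y × Near y z′

  a≢b : a ≢ b
  a≢b = off-≢ oA (≢-sym A≢𝐨)

  Aa : A at a ≢ 𝟙
  Aa e = off-diffˡ oA (≢-sym A≢𝐨) (trans (𝐨-at a) (sym e))

  Ab : A at b ≢ 𝟙
  Ab e = off-diffʳ oA (≢-sym A≢𝐨) (trans (𝐨-at b) (sym e))

  -- Off the line of the edge, a common neighbour agrees with `A` at one of `a`, `b` and with the
  -- origin at the other; the superscript names the position of agreement with `A`.
  data Side (z : Word) : Set where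
    line  : Off z 𝐨 a b → Side z
    sideᵃ : ∀ {c} → c ≢ a → c ≢ b → z at c ≢ 𝟙 → Off z 𝐨 a c → Off z A b c → Side z
    sideᵇ : ∀ {c} → c ≢ a → c ≢ b → z at c ≢ 𝟙 → Off z 𝐨 b c → Off z A a c → Side z

  side : ∀ {z} → Common z → Side z
  side {z} (z𝐨 , zA , _) with off? z 𝐨 a b
  ... | inj₁ o = line o
  ... | inj₂ (c , c≢a , c≢b , d) with off-line oA (≢-sym A≢𝐨) z𝐨 zA c≢a c≢b d
  ...   | inj₁ (o , oA′) = sideᵇ c≢a c≢b (λ e → d (trans e (sym (𝐨-at c)))) o oA′
  ...   | inj₂ (o , oA′) = sideᵃ c≢a c≢b (λ e → d (trans e (sym (𝐨-at c)))) o oA′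

  line-linked : ∀ {z z′} → Common z′ → Off z 𝐨 a b → Off z′ 𝐨 a b → Linked z z′
  line-linked c o o′ = _ , c , off⇒near (off-trans o (off-sym o′)) , off⇒near {a = a} {b = a} off-refl

  -- Without elements of order greater than 2, the words altered at a, c and
  -- at b, c are adjacent.
  module Exponent₂ (self-inverse : ∀ x → inv x ≡ x) where

    same : ∀ {v i j} → Off 𝐨 v i j → i ≢ j → v at j ≡ v at i
    same o i≢j = trans (support₂ o i≢j) (self-inverse _)

    cross : ∀ {z z′ c d} → c ≢ a → c ≢ b → d ≢ a → d ≢ b →
            Off z 𝐨 a c → Off z A b c → Off z′ 𝐨 b d → Off z′ A a d →
            ∃ λ y → Common y × Near z y × Near y z′
    -- `y` lies on the side of `z` but uses the third position of `z′`. Since symbols are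
    -- self-inverse, it has the symbol of `z′` there.
    cross {z} {z′} {c} {d} c≢a c≢b d≢a d≢b o oz o′ oz′ with move 𝐨 a (A at a) d (≢-sym d≢a)
    ... | y , oy , ya = y ,
      ( off⇒near oy
      , off⇒near (off-sym (off-through oA (off-sym oy) (sym ya)))
      , (λ e → Aa (trans (sym ya) (trans (cong (_at a) e) (𝐨-at a))))
      , (λ e → Ab (trans (cong (_at b) (sym e)) (trans (oy (≢-sym a≢b) (≢-sym d≢b)) (𝐨-at b)))) )
      , off⇒near (off-through (off-sym o) (off-sym oy) (trans (oz a≢b (≢-sym c≢a)) (sym ya)))
      , off⇒near (off-through (off-sym (off-swap oy)) (off-sym (off-swap o′)) (begin
          y at d   ≡⟨ same (off-sym oy) (≢-sym d≢a) ⟩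
          y at a   ≡⟨ ya ⟩
          A at a   ≡⟨ same oA a≢b ⟨
          A at b   ≡⟨ oz′ (≢-sym a≢b) (≢-sym d≢b) ⟨
          z′ at b  ≡⟨ same (off-sym o′) (≢-sym d≢b) ⟨
          z′ at d  ∎))
      where open ≡-Reasoning

    star-linked : ∀ {z z′} → Common z → Common z′ →
                  ¬ Off z 𝐨 a b → ¬ Off z′ 𝐨 a b → Linked z z′ ⊎ Linked z′ z
    star-linked c c′ n n′ with side c | side c′
    ... | line o | _ = ⊥-elim (n o)
    ... | sideᵃ _ _ _ _ _ | line o = ⊥-elim (n′ o)
    ... | sideᵇ _ _ _ _ _ | line o = ⊥-elim (n′ o)
    ... | sideᵃ c≢a c≢b _ o oz | sideᵃ d≢a d≢b _ o′ oz′ = inj₁ (_ , c′ ,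
            off⇒near (off-through (off-sym o) (off-sym o′)
              (trans (oz a≢b (≢-sym c≢a)) (sym (oz′ a≢b (≢-sym d≢a))))) ,
            off⇒near {a = a} {b = a} off-refl)
    ... | sideᵇ c≢a c≢b _ o oz | sideᵇ d≢a d≢b _ o′ oz′ = inj₁ (_ , c′ ,
            off⇒near (off-through (off-sym o) (off-sym o′)
              (trans (oz (≢-sym a≢b) (≢-sym c≢b)) (sym (oz′ (≢-sym a≢b) (≢-sym d≢b))))) ,
            off⇒near {a = a} {b = a} off-refl)
    ... | sideᵃ c≢a c≢b _ o oz | sideᵇ d≢a d≢b _ o′ oz′ = inj₁ (cross c≢a c≢b d≢a d≢b o oz o′ oz′)
    ... | sideᵇ c≢a c≢b _ o oz | sideᵃ d≢a d≢b _ o′ oz′ = inj₂ (cross d≢a d≢b c≢a c≢b o′ oz′ o oz)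

  module NonInvolution (not-self-inverse : A at a ≢ inv (A at a)) where

    -- The words differ at `a` and `b`, so they would have to share their third position. There `z`
    -- has the inverse of `A at a`, but `z′` has `A at a` itself.
    opposite-sides : ∀ {z z′ c d} → Near z z′ →
      c ≢ a → c ≢ b → d ≢ a → d ≢ b → z at c ≢ 𝟙 →
      Off z 𝐨 a c → Off z A b c → Off z′ 𝐨 b d → Off z′ A a d → ⊥
    opposite-sides {z} {z′} {c} {d} n c≢a c≢b d≢a d≢b zc o oz o′ oz′ =
      not-self-inverse A≡A⁻
      where
      open ≡-Reasoning
      za : z at a ≡ A at a
      za = oz a≢b (≢-sym c≢a)

      z-z′ : Off z z′ a b
      z-z′ = near-diff₂ n a≢b
        (λ e → Aa (trans (sym za) (trans e (trans (o′ a≢b (≢-sym d≢a)) (𝐨-at a)))))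
        (λ e → Ab (trans (sym (oz′ (≢-sym a≢b) (≢-sym d≢b)))
                    (trans (sym e) (trans (o (≢-sym a≢b) (≢-sym c≢b)) (𝐨-at b)))))

      d≡c : d ≡ c
      d≡c = off-pin o′ c≢b (λ e → zc (trans (z-z′ c≢a c≢b) (trans e (𝐨-at c))))

      A≡A⁻ : A at a ≡ inv (A at a)
      A≡A⁻ = begin
        A at a           ≡⟨ inv-involutive _ ⟨
        inv (inv (A at a))  ≡⟨ cong inv (support₂ oA a≢b) ⟨
        inv (A at b)       ≡⟨ cong inv (oz′ (≢-sym a≢b) (≢-sym d≢b)) ⟨
        inv (z′ at b)      ≡⟨ support₂ (off-sym o′) (≢-sym d≢b) ⟨
        z′ at d          ≡⟨ cong (z′ at_) d≡c ⟩
        z′ at c          ≡⟨ z-z′ c≢a c≢b ⟨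
        z at c           ≡⟨ support₂ (off-sym o) (≢-sym c≢a) ⟩
        inv (z at a)       ≡⟨ cong inv za ⟩
        inv (A at a)       ∎

    -- The symbol at `a` tells the components apart: it is `A at a` on one side, `𝟙` on the other
    -- and neither on the line. A word of the line and one of a side differ at `a`, `b` and the
    -- third position, and `opposite-sides` separates the two sides.
    near-sideᵃ : ∀ {z z′} → Common z → Common z′ → Near z z′ → z at a ≡ A at a → z′ at a ≡ A at a
    near-sideᵃ {z} {z′} com@(_ , _ , _ , z≢A) com′@(_ , _ , z′≢𝐨 , _) n za with side com | side com′
    ... | line o | _ = ⊥-elim (z≢A (off-extˡ (off-trans o oA) za))
    ... | sideᵇ c≢a _ _ o _ | _ = ⊥-elim (Aa (trans (sym za) (trans (o a≢b (≢-sym c≢a)) (𝐨-at a))))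
    ... | sideᵃ _ _ _ _ _ | sideᵃ d≢a _ _ _ oz′ = oz′ a≢b (≢-sym d≢a)
    ... | sideᵃ {c} c≢a c≢b zc o oz | line o′ with z′ at a ≟ₛ z at a
    ...   | yes e = trans e za
    ...   | no ne = ⊥-elim (near-diff₃ n a≢b c≢a c≢b (≢-sym ne)
            (λ e → off-diffʳ o′ z′≢𝐨 (trans (sym e) (o (≢-sym a≢b) (≢-sym c≢b))))
            (λ e → zc (trans e (trans (o′ c≢a c≢b) (𝐨-at c)))))
    near-sideᵃ com com′ n za | sideᵃ c≢a c≢b zc o oz | sideᵇ d≢a d≢b _ o′ oz′ =
      ⊥-elim (opposite-sides n c≢a c≢b d≢a d≢b zc o oz o′ oz′)

    near-sideᵇ : ∀ {z z′} → Common z → Common z′ → Near z z′ → z at a ≡ 𝟙 → z′ at a ≡ 𝟙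
    near-sideᵇ {z} {z′} com@(_ , _ , z≢𝐨 , _) com′@(_ , _ , _ , z′≢A) n za with side com | side com′
    ... | line o | _ = ⊥-elim (z≢𝐨 (off-extˡ o (trans za (sym (𝐨-at a)))))
    ... | sideᵃ c≢a _ _ _ oz | _ = ⊥-elim (Aa (trans (sym (oz a≢b (≢-sym c≢a))) za))
    ... | sideᵇ _ _ _ _ _ | sideᵇ d≢a _ _ o′ _ = trans (o′ a≢b (≢-sym d≢a)) (𝐨-at a)
    ... | sideᵇ _ _ _ _ _ | sideᵃ d≢a _ _ _ oz′ =
            ⊥-elim (Aa (trans (sym (near-sideᵃ com′ com (near-sym n) (oz′ a≢b (≢-sym d≢a)))) za))
    ... | sideᵇ {c} c≢a c≢b zc o oz | line o′ with z′ at a ≟ₛ z at a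
    ...   | yes e = trans e za
    ...   | no ne = ⊥-elim (near-diff₃ n a≢b c≢a c≢b (≢-sym ne)
            (λ e → off-diffʳ (off-trans o′ oA) z′≢A
              (trans (sym e) (oz (≢-sym a≢b) (≢-sym c≢b))))
            (λ e → zc (trans e (trans (o′ c≢a c≢b) (𝐨-at c)))))

module _ {C D : Code} (φ : CodeIso C D) where
  open Code C
  open CodeProperties C
  open CodeIso φ
  private
    module D where
      open Code D public
      open CodeProperties D public

  -- The common neighbours of an edge with symbol x ≢ inv x at the origin form at
  -- least three connected components, but those of any edge at the origin form
  -- at most two if all symbols are self-inverse.
  no-iso-to-self-inverse : {𝐨 : Word} {𝟙 : Symbol} {𝟙′ : D.Symbol} →
    (∀ i → 𝐨 at i ≡ 𝟙) → (∀ i → to 𝐨 D.at i ≡ 𝟙′) →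
    (inv : Symbol → Symbol) (inv′ : D.Symbol → D.Symbol) →
    (∀ x → inv (inv x) ≡ x) → (∀ x → inv′ x ≡ x) →
    (∀ {v i j} → Off 𝐨 v i j → i ≢ j → v at j ≡ inv (v at i)) →
    (∀ {v i j} → D.Off (to 𝐨) v i j → i ≢ j → v D.at j ≡ inv′ (v D.at i)) →
    ∀ {i j k x s} → i ≢ j → i ≢ k → j ≢ k → x ≢ inv x → x ≢ 𝟙 → s ≢ 𝟙 → s ≢ x → ⊥
  no-iso-to-self-inverse {𝐨} {𝟙} {𝟙′} 𝐨-at φ𝐨-at inv inv′ inv-inv inv′≡ supp supp′
    {i} {j} {k} {x} {s} i≢j i≢k j≢k x≢inv x≢𝟙 s≢𝟙 s≢x
    with move 𝐨 i x j i≢j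
  ... | A , A-𝐨 , Ai
    with move 𝐨 i s j i≢j | move 𝐨 i x k i≢k | move 𝐨 j (A at j) k j≢k
  -- Representatives of three components: `Z` on the line of the edge, `W` and `W′` on its two
  -- sides.
  ... | Z , Z-𝐨 , Zi | W , W-𝐨 , Wi | W′ , W′-𝐨 , W′j = two-on-a-side
    where
    not-𝐨 : ∀ {v l y} → v at l ≡ y → y ≢ 𝟙 → v ≢ 𝐨
    not-𝐨 e y≢𝟙 v≡𝐨 = y≢𝟙 (trans (sym e) (trans (cong (_at _) v≡𝐨) (𝐨-at _)))

    apart : ∀ {v w l y z} → v at l ≡ y → w at l ≡ z → y ≢ z → v ≢ w
    apart refl refl y≢z refl = y≢z refl

    A≢𝐨 : A ≢ 𝐨
    A≢𝐨 = not-𝐨 Ai x≢𝟙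

    oA : Off 𝐨 A i j
    oA = off-sym A-𝐨

    Aj : A at j ≢ 𝟙
    Aj e = off-diffʳ oA (≢-sym A≢𝐨) (trans (𝐨-at j) (sym e))

    module N = CommonNeighbours C 𝐨-at inv inv-inv supp oA A≢𝐨
    module NN = N.NonInvolution (λ e → x≢inv (trans (sym Ai) (trans e (cong inv Ai))))

    W′i : W′ at i ≡ 𝟙
    W′i = trans (W′-𝐨 i≢j i≢k) (𝐨-at i)

    cZ : N.Common Z
    cZ = off⇒near Z-𝐨 , off⇒near (off-trans Z-𝐨 oA) , not-𝐨 Zi s≢𝟙 , apart Zi Ai s≢x

    cW : N.Common W
    cW = off⇒near W-𝐨 , off⇒near (off-through (off-sym W-𝐨) oA (trans Wi (sym Ai))) ,
         not-𝐨 Wi x≢𝟙 , apart (trans (W-𝐨 (≢-sym i≢j) j≢k) (𝐨-at j)) refl (≢-sym Aj)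

    cW′ : N.Common W′
    cW′ = off⇒near W′-𝐨 , off⇒near (off-through (off-sym W′-𝐨) (off-swap oA) W′j) ,
          not-𝐨 W′j Aj , apart W′i Ai (≢-sym x≢𝟙)

    unlinked-W : ∀ {z} → N.Common z → z at i ≢ x → ¬ N.Linked W z
    unlinked-W c zi (y , cy , Wy , yz) = zi (trans (NN.near-sideᵃ cy c yz
      (NN.near-sideᵃ cW cy Wy (trans Wi (sym Ai)))) Ai)

    unlinked-W′ : ∀ {z} → N.Common z → z at i ≢ 𝟙 → ¬ N.Linked W′ z
    unlinked-W′ c zi (y , cy , Wy , yz) = zi (NN.near-sideᵇ cy c yz (NN.near-sideᵇ cW′ cy Wy W′i))

    linked-sym : ∀ {z z′} → N.Linked z z′ → N.Linked z′ z
    linked-sym (y , cy , n , n′) = y , cy , near-sym n′ , near-sym n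

    two-on-a-side : ⊥
    two-on-a-side with to-near (off⇒near oA)
    ... | a , b , φoA = split
            (D.off? (to Z) (to 𝐨) a b) (D.off? (to W) (to 𝐨) a b) (D.off? (to W′) (to 𝐨) a b)
      where
      module M = CommonNeighbours D φ𝐨-at inv′ (λ y → trans (inv′≡ _) (inv′≡ y)) supp′ φoA (to-≢ A≢𝐨)
      module ME = M.Exponent₂ inv′≡

      forth : ∀ {z} → N.Common z → M.Common (to z)
      forth (z𝐨 , zA , z≢𝐨 , z≢A) = to-near z𝐨 , to-near zA , to-≢ z≢𝐨 , to-≢ z≢A

      back : ∀ {z z′} → M.Linked (to z) (to z′) → N.Linked z z′
      back {z} {z′} (y , (y𝐨 , yA , y≢𝐨 , y≢A) , zy , yz′) = from y ,
        ( to-near⁻¹ (subst (λ y → D.Near y _) (sym (to-from y)) y𝐨)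
        , to-near⁻¹ (subst (λ y → D.Near y _) (sym (to-from y)) yA)
        , (λ e → y≢𝐨 (trans (sym (to-from y)) (cong to e)))
        , (λ e → y≢A (trans (sym (to-from y)) (cong to e))) ) ,
        to-near⁻¹ (subst (D.Near _) (sym (to-from y)) zy) ,
        to-near⁻¹ (subst (λ y → D.Near y _) (sym (to-from y)) yz′)

      Inside : Word → Set
      Inside z = D.Off (to z) (to 𝐨) a b

      Outside : Word → Set
      Outside z = ∃ λ c → c ≢ a × c ≢ b × D.Diff (to z) (to 𝐨) c

      not-on : ∀ {z} → Outside z → ¬ Inside z
      not-on (_ , c≢a , c≢b , d) o = d (o c≢a c≢b)

      both-on : ∀ {z z′} → N.Common z′ → Inside z → Inside z′ → N.Linked z z′
      both-on c′ o o′ = back (M.line-linked (forth c′) o o′)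

      both-outside : ∀ {z z′} → N.Common z → N.Common z′ → Outside z → Outside z′ → N.Linked z z′
      both-outside c c′ o o′ with ME.star-linked (forth c) (forth c′) (not-on o) (not-on o′)
      ... | inj₁ l = back l
      ... | inj₂ l = linked-sym (back l)

      W-Z : ¬ N.Linked W Z
      W-Z = unlinked-W cZ (λ e → s≢x (trans (sym Zi) e))

      W-W′ : ¬ N.Linked W W′
      W-W′ = unlinked-W cW′ (λ e → x≢𝟙 (trans (sym e) W′i))

      W′-Z : ¬ N.Linked W′ Z
      W′-Z = unlinked-W′ cZ (λ e → s≢𝟙 (trans (sym Zi) e))

      -- Pigeonhole: two of the three images are both on the image line or both off it. Either way
      -- they are linked, while no two of `Z`, `W`, `W′` are.
      split : Inside Z ⊎ Outside Z → Inside W ⊎ Outside W → Inside W′ ⊎ Outside W′ → ⊥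
      split (inj₁ oZ) (inj₁ oW) _         = W-Z (both-on cZ oW oZ)
      split (inj₁ oZ) (inj₂ _) (inj₁ oW′) = W′-Z (both-on cZ oW′ oZ)
      split (inj₁ _) (inj₂ oW) (inj₂ oW′) = W-W′ (both-outside cW cW′ oW oW′)
      split (inj₂ _) (inj₁ oW) (inj₁ oW′) = W-W′ (both-on cW′ oW oW′)
      split (inj₂ oZ) (inj₁ _) (inj₂ oW′) = W′-Z (both-outside cW′ cZ oW′ oZ)
      split (inj₂ oZ) (inj₂ oW) _         = W-Z (both-outside cW cZ oW oZ)

-- Finite sets and small groups

-- A missed value `y` would extend `f` to an injection of `suc n` elements into `n`.
injective⇒surjective : ∀ {n} (f : Fin n → Fin n) → (∀ {i j} → f i ≡ f j → i ≡ j) →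
                       ∀ y → ∃ λ i → f i ≡ y
injective⇒surjective {n} f f-inj y with Fin.any? (λ i → f i ≟ y)
... | yes i = i
... | no ∄i = ⊥-elim (ℕ.1+n≰n (Fin.injective⇒≤ {f = g} g-inj))
  where
  g : Fin (suc n) → Fin n
  g zero    = y
  g (suc i) = f i
  g-inj : ∀ {i j} → g i ≡ g j → i ≡ j
  g-inj {zero}  {zero}  _ = refl
  g-inj {zero}  {suc j} e = ⊥-elim (∄i (j , sym e))
  g-inj {suc i} {zero}  e = ⊥-elim (∄i (i , e))
  g-inj {suc i} {suc j} e = cong suc (f-inj e)

lookup-injective : ∀ {A : Set} {xs : List A} → Unique xs → ∀ {i j} → lookup xs i ≡ lookup xs j → i ≡ j
lookup-injective (_ ∷ u) {zero}  {zero}  _ = refl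
lookup-injective (n ∷ u) {zero}  {suc j} e = contradiction e (All.lookup n (∈-lookup j))
lookup-injective (n ∷ u) {suc i} {zero}  e = sym (lookup-injective (n ∷ u) (sym e))
lookup-injective (_ ∷ u) {suc i} {suc j} e = cong suc (lookup-injective u e)

Vec-↔ : ∀ {A : Set} {n} → A ↔ Fin n → ∀ m → Vec A m ↔ Fin (n ^ m)
Vec-↔ A↔ zero = mk↔ₛ′ (λ _ → zero) (λ _ → []) (λ { zero → refl }) (λ { [] → refl })
Vec-↔ {A} A↔ (suc m) = ↔-trans uncons (↔-trans (A↔ ×-↔ Vec-↔ A↔ m) (↔-sym Fin.*↔×))
  where
  uncons : Vec A (suc m) ↔ (A × Vec A m)
  uncons = mk↔ₛ′ (λ { (x ∷ xs) → x , xs }) (λ { (x , xs) → x ∷ xs }) (λ _ → refl) (λ { (_ ∷ _) → refl })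

^-cancelʳ-≡ : ∀ a b m .{{_ : NonZero m}} → a ^ m ≡ b ^ m → a ≡ b
^-cancelʳ-≡ a b m e with ℕ.<-cmp a b
... | tri< a<b _ _ = contradiction e (ℕ.<⇒≢ (ℕ.^-monoˡ-< m a<b))
... | tri≈ _ a≡b _ = a≡b
... | tri> _ _ b<a = contradiction (sym e) (ℕ.<⇒≢ (ℕ.^-monoˡ-< m b<a))

Vec-↔⇒size-≡ : ∀ (G H : FiniteGroup) m .{{_ : NonZero m}} →
               Vec (Carrier G) m ↔ Vec (Carrier H) m → size G ≡ size H
Vec-↔⇒size-≡ G H m v = ^-cancelʳ-≡ _ _ m
  (↔⇒≡ (↔-trans (↔-sym (Vec-↔ (finite G) m)) (↔-trans v (Vec-↔ (finite H) m))))

module Counting (G : FiniteGroup) where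
  open Elements G

  element : Fin (size G) → Element
  element = Inverse.from (finite G)

  element-index : ∀ x → element (index x) ≡ x
  element-index = Inverse.strictlyInverseʳ (finite G)

  element-injective : ∀ {i j} → element i ≡ element j → i ≡ j
  element-injective e = trans (sym (Inverse.strictlyInverseˡ (finite G) _))
    (trans (cong index e) (Inverse.strictlyInverseˡ (finite G) _))

  unique⇒length≤ : ∀ {xs} → Unique xs → length xs ℕ.≤ size G
  unique⇒length≤ u = Fin.injective⇒≤ λ e → lookup-injective u (index-injective e)

  fresh : ∀ xs → length xs ℕ.< size G → ∃ λ q → q ∉ xs
  fresh xs l<n with Fin.any? (λ i → ¬? (DecMembership._∈?_ _≟ᵉ_ (element i) xs))
  ... | yes (i , i∉) = element i , i∉
  ... | no ∄ = ⊥-elim (ℕ.<⇒≱ l<n (Fin.injective⇒≤ {f = λ i → ∈-index (mem i)}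
                 λ {i} {j} e → element-injective (∈-index-injective (setoid _) (mem i) (mem j) e)))
    where
    mem : ∀ i → element i ∈ xs
    mem i = decidable-stable (DecMembership._∈?_ _≟ᵉ_ (element i) xs) λ i∉ → ∄ (i , i∉)

  decide-all : ∀ {P : Element → Set} → (∀ x → Dec (P x)) → (∀ x → P x) ⊎ ∃ λ x → ¬ P x
  decide-all {P} P? with Fin.any? (λ i → ¬? (P? (element i)))
  ... | yes (i , ¬p) = inj₂ (element i , ¬p)
  ... | no ∄ = inj₁ λ x → decidable-stable (P? x)
    λ ¬p → ∄ (index x , λ p → ¬p (subst P (element-index x) p))

  pow : Element → ℕ → Element
  pow x zero    = 𝟙
  pow x (suc n) = x · pow x n

  pow-+ : ∀ x m n → pow x (m ℕ.+ n) ≡ pow x m · pow x n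
  pow-+ x zero    n = sym (identityˡ _)
  pow-+ x (suc m) n = trans (cong (x ·_) (pow-+ x m n)) (sym (assoc _ _ _))

module _ (G H : FiniteGroup) (sizes : size G ≡ size H) where
  private
    module G where
      open Elements G public
      open Counting G public
    module H where
      open Elements H public
      open Counting H public

  injection⇒surjection : (f : G.Element → H.Element) → (∀ {x y} → f x ≡ f y → x ≡ y) →
                         ∀ y → ∃ λ x → f x ≡ y
  injection⇒surjection f f-inj y
    with injective⇒surjective (λ i → H.index (f (G.element (Fin.cast (sym sizes) i))))
      (λ e → Fin.toℕ-injective (trans (sym (Fin.toℕ-cast (sym sizes) _))
        (trans (cong toℕ (G.element-injective (f-inj (H.index-injective e)))) (Fin.toℕ-cast (sym sizes) _))))
      (H.index y)
  ... | i , e = _ , H.index-injective e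

  injective-hom⇒iso : (f : G.Element → H.Element) → (∀ {x y} → f x ≡ f y → x ≡ y) →
                      (∀ x y → f (x G.· y) ≡ f x H.· f y) → GroupIso G H
  injective-hom⇒iso f f-inj hom = record
    { bij = mk↔ₛ′ f (proj₁ ∘ surj) (proj₂ ∘ surj) (λ x → f-inj (proj₂ (surj (f x))))
    ; hom = hom
    }
    where surj = injection⇒surjection f f-inj

  pointed-injection : ∃ λ (f : G.Element → H.Element) → (∀ {x y} → f x ≡ f y → x ≡ y) × f G.𝟙 ≡ H.𝟙
  pointed-injection = (λ x → f₀ x H.· f₀ G.𝟙 H.⁻) , f₀-inj ∘ H.∙-cancelʳ _ _ _ , H.inverseʳ _
    where
    f₀ : G.Element → H.Element
    f₀ x = H.element (Fin.cast sizes (G.index x))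
    f₀-inj : ∀ {x y} → f₀ x ≡ f₀ y → x ≡ y
    f₀-inj e = G.index-injective (Fin.toℕ-injective (trans (sym (Fin.toℕ-cast sizes _))
      (trans (cong toℕ (H.element-injective e)) (Fin.toℕ-cast sizes _))))

  -- The first `n` powers of `x` are distinct and so exhaust `G`. Sending each to the same power of
  -- `y` is a homomorphism because in both groups exponents matter only modulo `n`.
  cyclic-iso : ∀ {n} .{{_ : NonZero n}} x y → size G ≡ n →
    G.pow x n ≡ G.𝟙 → H.pow y n ≡ H.𝟙 →
    (∀ {i j} → i ℕ.< n → j ℕ.< n → G.pow x i ≡ G.pow x j → i ≡ j) →
    (∀ {i j} → i ℕ.< n → j ℕ.< n → H.pow y i ≡ H.pow y j → i ≡ j) → GroupIso G H
  cyclic-iso {n} x y refl xⁿ yⁿ x-inj y-inj = injective-hom⇒iso f f-inj f-hom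
    where
    module Period (K : FiniteGroup) where
      open Elements K
      open Counting K
      pow-* : ∀ z → pow z n ≡ 𝟙 → ∀ q → pow z (q ℕ.* n) ≡ 𝟙
      pow-* z zⁿ zero    = refl
      pow-* z zⁿ (suc q) = trans (pow-+ z n (q ℕ.* n))
        (trans (cong₂ _·_ zⁿ (pow-* z zⁿ q)) (identityˡ 𝟙))
      pow-% : ∀ z → pow z n ≡ 𝟙 → ∀ i → pow z i ≡ pow z (i % n)
      pow-% z zⁿ i = trans (cong (pow z) (m≡m%n+[m/n]*n i n))
        (trans (pow-+ z (i % n) (i / n ℕ.* n))
          (trans (cong (pow z (i % n) ·_) (pow-* z zⁿ (i / n))) (identityʳ _)))

    log : ∀ g → ∃ λ i → G.pow x (toℕ i) ≡ g
    log g with injective⇒surjective (λ i → G.index (G.pow x (toℕ i)))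
      (λ e → Fin.toℕ-injective (x-inj (Fin.toℕ<n _) (Fin.toℕ<n _) (G.index-injective e))) (G.index g)
    ... | i , e = i , G.index-injective e

    exponent : G.Element → ℕ
    exponent g = toℕ (proj₁ (log g))

    f : G.Element → H.Element
    f g = H.pow y (exponent g)

    f-inj : ∀ {g h} → f g ≡ f h → g ≡ h
    f-inj {g} {h} e = trans (sym (proj₂ (log g)))
      (trans (cong (G.pow x) (y-inj {exponent g} {exponent h} (Fin.toℕ<n _) (Fin.toℕ<n _) e)) (proj₂ (log h)))

    kernel : ∀ i j → G.pow x i ≡ G.pow x j → H.pow y i ≡ H.pow y j
    kernel i j e = trans (Period.pow-% H y yⁿ i)
      (trans (cong (H.pow y) (x-inj (m%n<n i n) (m%n<n j n)
        (trans (sym (Period.pow-% G x xⁿ i)) (trans e (Period.pow-% G x xⁿ j)))))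
      (sym (Period.pow-% H y yⁿ j)))

    f-hom : ∀ g h → f (g G.· h) ≡ f g H.· f h
    f-hom g h = trans
      (kernel (exponent (g G.· h)) (exponent g ℕ.+ exponent h)
        (trans (proj₂ (log (g G.· h)))
          (sym (trans (G.pow-+ x (exponent g) (exponent h)) (cong₂ G._·_ (proj₂ (log g)) (proj₂ (log h)))))))
      (H.pow-+ y (exponent g) (exponent h))

  -- In a group with at most three elements, or with at most four if all squares
  -- are trivial, every product is determined by exclusion.
  Small : Set
  Small = size G ℕ.≤ 3 ⊎
          (size G ℕ.≤ 4 × (∀ x → x G.· x ≡ G.𝟙) × (∀ y → y H.· y ≡ H.𝟙))

  small-iso : Small → GroupIso G H
  small-iso small with pointed-injection
  ... | f , f-inj , f𝟙 = injective-hom⇒iso f f-inj hom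
    where
    f-≢ : ∀ {x y} → x ≢ y → f x ≢ f y
    f-≢ x≢y = x≢y ∘ f-inj

    ·-≢ˡ : ∀ {x y} → y ≢ G.𝟙 → x G.· y ≢ x
    ·-≢ˡ y≢𝟙 e = y≢𝟙 (G.∙-cancelˡ _ _ _ (trans e (sym (G.identityʳ _))))

    ·-≢ʳ : ∀ {x y} → x ≢ G.𝟙 → x G.· y ≢ y
    ·-≢ʳ x≢𝟙 e = x≢𝟙 (G.∙-cancelʳ _ _ _ (trans e (sym (G.identityˡ _))))

    ·-≢ˡ′ : ∀ {x y} → y ≢ H.𝟙 → x H.· y ≢ x
    ·-≢ˡ′ y≢𝟙 e = y≢𝟙 (H.∙-cancelˡ _ _ _ (trans e (sym (H.identityʳ _))))

    ·-≢ʳ′ : ∀ {x y} → x ≢ H.𝟙 → x H.· y ≢ y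
    ·-≢ʳ′ x≢𝟙 e = x≢𝟙 (H.∙-cancelʳ _ _ _ (trans e (sym (H.identityˡ _))))

    module _ {p q s : G.Element} (p≢𝟙 : p ≢ G.𝟙) (q≢𝟙 : q ≢ G.𝟙)
             (fs : f s ≡ f p H.· f q) (pq≢s : p G.· q ≢ s) where
      fp≢𝟙 : f p ≢ H.𝟙
      fp≢𝟙 e = f-≢ p≢𝟙 (trans e (sym f𝟙))
      fq≢𝟙 : f q ≢ H.𝟙
      fq≢𝟙 e = f-≢ q≢𝟙 (trans e (sym f𝟙))
      p≢s : p ≢ s
      p≢s refl = ·-≢ˡ′ fq≢𝟙 (sym fs)
      q≢s : q ≢ s
      q≢s refl = ·-≢ʳ′ fp≢𝟙 (sym fs)
      p≢pq : p ≢ p G.· q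
      p≢pq e = ·-≢ˡ q≢𝟙 (sym e)
      q≢pq : q ≢ p G.· q
      q≢pq e = ·-≢ʳ p≢𝟙 (sym e)

      four : p ≢ q → 4 ℕ.≤ size G
      four p≢q = G.unique⇒length≤ ((p≢q ∷ p≢pq ∷ p≢s ∷ []) ∷ (q≢pq ∷ q≢s ∷ []) ∷ (pq≢s ∷ []) ∷ [] ∷ [])

    -- A wrong product leaves too many distinct elements. For `p ≢ q` these are `p`, `q`, `p G.· q`
    -- and `s`, joined by `𝟙` when squares are trivial. For `p ≡ q`, trivial squares agree at once;
    -- otherwise four elements are found according to which of `p G.· p` and `s` is `𝟙`.
    impossible : ∀ {p q s} → Small → p ≢ G.𝟙 → q ≢ G.𝟙 → f s ≡ f p H.· f q → p G.· q ≢ s → ⊥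
    impossible {p} {q} {s} (inj₁ n≤3) p≢𝟙 q≢𝟙 fs pq≢s with p G.≟ᵉ q
    ... | no p≢q = ℕ.<⇒≱ (four p≢𝟙 q≢𝟙 fs pq≢s p≢q) n≤3
    ... | yes refl with p G.· p G.≟ᵉ G.𝟙 | s G.≟ᵉ G.𝟙
    ...   | yes pp | _ = ℕ.<⇒≱ (G.unique⇒length≤
              ( (≢-sym p≢𝟙 ∷ 𝟙≢s ∷ (λ e → p≢s p≢𝟙 q≢𝟙 fs pq≢s (G.∙-cancelˡ p _ _ (trans pp e))) ∷ [])
              ∷ (p≢s p≢𝟙 q≢𝟙 fs pq≢s ∷ ≢-sym (·-≢ˡ (≢-sym 𝟙≢s)) ∷ [])
              ∷ (≢-sym (·-≢ʳ p≢𝟙) ∷ []) ∷ [] ∷ [])) n≤3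
      where
      𝟙≢s : G.𝟙 ≢ s
      𝟙≢s e = pq≢s (trans pp e)
    ...   | no pp≢𝟙 | no s≢𝟙 = ℕ.<⇒≱ (G.unique⇒length≤
              ( (≢-sym p≢𝟙 ∷ ≢-sym pp≢𝟙 ∷ ≢-sym s≢𝟙 ∷ [])
              ∷ (p≢pq p≢𝟙 q≢𝟙 fs pq≢s ∷ p≢s p≢𝟙 q≢𝟙 fs pq≢s ∷ [])
              ∷ (pq≢s ∷ []) ∷ [] ∷ [])) n≤3
    -- Now it is `f p` that has a trivial square, so the count takes place in `H`: `𝟙`, `f p`,
    -- `f (p G.· p)` and the product of the last two.
    ...   | no pp≢𝟙 | yes refl = ℕ.<⇒≱ (H.unique⇒length≤
              ( (≢-sym fp ∷ ≢-sym fr ∷ (λ e → p≢pq p≢𝟙 q≢𝟙 fs pq≢s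
                  (f-inj (H.∙-cancelˡ (f p) _ _ (trans (trans (sym fs) f𝟙) e)))) ∷ [])
              ∷ (f-≢ (p≢pq p≢𝟙 q≢𝟙 fs pq≢s) ∷ ≢-sym (·-≢ˡ′ fr) ∷ [])
              ∷ (≢-sym (·-≢ʳ′ fp) ∷ []) ∷ [] ∷ [])) (subst (ℕ._≤ 3) sizes n≤3)
      where
      fp : f p ≢ H.𝟙
      fp = fp≢𝟙 p≢𝟙 q≢𝟙 fs pq≢s
      fr : f (p G.· p) ≢ H.𝟙
      fr e = pp≢𝟙 (f-inj (trans e (sym f𝟙)))
    impossible {p} {q} {s} (inj₂ (n≤4 , sqG , sqH)) p≢𝟙 q≢𝟙 fs pq≢s with p G.≟ᵉ q
    ... | yes refl =
      pq≢s (trans (sqG p) (f-inj (trans f𝟙 (sym (trans fs (sqH (f p)))))))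
    ... | no p≢q =
      ℕ.<⇒≱ (G.unique⇒length≤
        ( (≢-sym p≢𝟙 ∷ ≢-sym q≢𝟙 ∷ (λ e → p≢q (G.∙-cancelˡ p _ _ (trans (sqG p) e)))
            ∷ (λ e → p≢q (f-inj (H.∙-cancelˡ (f p) _ _
                 (trans (sqH (f p)) (trans (sym f𝟙) (trans (cong f e) fs)))))) ∷ [])
        ∷ (p≢q ∷ p≢pq p≢𝟙 q≢𝟙 fs pq≢s ∷ p≢s p≢𝟙 q≢𝟙 fs pq≢s ∷ [])
        ∷ (q≢pq p≢𝟙 q≢𝟙 fs pq≢s ∷ q≢s p≢𝟙 q≢𝟙 fs pq≢s ∷ [])
        ∷ (pq≢s ∷ []) ∷ [] ∷ [])) n≤4

    hom : ∀ p q → f (p G.· q) ≡ f p H.· f q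
    hom p q with p G.≟ᵉ G.𝟙 | q G.≟ᵉ G.𝟙
    ... | yes refl | _ = trans (cong f (G.identityˡ q)) (sym (trans (cong (H._· f q) f𝟙) (H.identityˡ _)))
    ... | no _ | yes refl = trans (cong f (G.identityʳ p)) (sym (trans (cong (f p H.·_) f𝟙) (H.identityʳ _)))
    ... | no p≢𝟙 | no q≢𝟙 with injection⇒surjection f f-inj (f p H.· f q)
    ...   | s , fs with p G.· q G.≟ᵉ s
    ...     | yes refl = fs
    ...     | no pq≢s  = ⊥-elim (impossible small p≢𝟙 q≢𝟙 fs pq≢s)

module OrderFour (G : FiniteGroup) (n≡4 : size G ≡ 4) where
  open Elements G
  open Counting G

  module _ {x} (x²≢𝟙 : x · x ≢ 𝟙) where
    private
      at-most-4 : ∀ {xs} → Unique xs → ¬ 5 ℕ.≤ length xs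
      at-most-4 u 5≤ = ℕ.<⇒≱ (ℕ.≤-trans 5≤ (unique⇒length≤ u)) (ℕ.≤-reflexive n≡4)

      ≢-cong : ∀ {y z} → y ≢ z → x · y ≢ x · z
      ≢-cong y≢z e = y≢z (∙-cancelˡ x _ _ e)

      n₁ : pow x 0 ≢ pow x 1
      n₁ e = x²≢𝟙 (trans (cong₂ _·_ x≡𝟙 x≡𝟙) (identityˡ 𝟙))
        where x≡𝟙 = trans (sym (identityʳ x)) (sym e)

      n₂ : pow x 0 ≢ pow x 2
      n₂ e = x²≢𝟙 (trans (cong (x ·_) (sym (identityʳ x))) (sym e))

      -- If the cube were trivial, the three powers of `x` together with `s` and `x · s`, for any
      -- other `s`, would be five elements.
      n₃ : pow x 0 ≢ pow x 3
      n₃ e with fresh (pow x 0 ∷ pow x 1 ∷ pow x 2 ∷ []) (ℕ.≤-reflexive (sym n≡4))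
      ... | s , s∉ = at-most-4
        ( (n₁ ∷ n₂ ∷ s₀ ∷ (λ e′ → s₂ (∙-cancelˡ x _ _ (trans (sym e) e′))) ∷ [])
        ∷ (≢-cong n₁ ∷ s₁ ∷ ≢-cong s₀ ∷ [])
        ∷ (s₂ ∷ ≢-cong s₁ ∷ [])
        ∷ ((λ e′ → n₁ (sym (∙-cancelʳ s _ _
             (trans (cong (_· s) (identityʳ x)) (trans (sym e′) (sym (identityˡ s))))))) ∷ [])
        ∷ [] ∷ []) ℕ.≤-refl
        where
        s₀ : pow x 0 ≢ s
        s₀ e = s∉ (here (sym e))
        s₁ : pow x 1 ≢ s
        s₁ e = s∉ (there (here (sym e)))
        s₂ : pow x 2 ≢ s
        s₂ e = s∉ (there (there (here (sym e))))

    pow-4 : pow x 4 ≡ 𝟙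
    pow-4 with pow x 4 ≟ᵉ 𝟙
    ... | yes e = e
    ... | no n₄ = ⊥-elim (at-most-4
      ( (n₁ ∷ n₂ ∷ n₃ ∷ ≢-sym n₄ ∷ [])
      ∷ (≢-cong n₁ ∷ ≢-cong n₂ ∷ ≢-cong n₃ ∷ [])
      ∷ (≢-cong (≢-cong n₁) ∷ ≢-cong (≢-cong n₂) ∷ [])
      ∷ (≢-cong (≢-cong (≢-cong n₁)) ∷ []) ∷ [] ∷ []) ℕ.≤-refl)

    pow-injective : ∀ {i j} → i ℕ.< 4 → j ℕ.< 4 → pow x i ≡ pow x j → i ≡ j
    pow-injective {i} {j} i<4 j<4 e = Fin.fromℕ<-injective i j i<4 j<4
      (lookup-injective unique (trans (sym (agree i i<4)) (trans e (agree j j<4))))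
      where
      powers : List Element
      powers = pow x 0 ∷ pow x 1 ∷ pow x 2 ∷ pow x 3 ∷ []
      unique : Unique powers
      unique = (n₁ ∷ n₂ ∷ n₃ ∷ []) ∷ (≢-cong n₁ ∷ ≢-cong n₂ ∷ []) ∷ (≢-cong (≢-cong n₁) ∷ []) ∷ [] ∷ []
      agree : ∀ i (i<4 : i ℕ.< 4) → pow x i ≡ lookup powers (fromℕ< i<4)
      agree 0 _ = refl
      agree 1 (s≤s (s≤s _)) = refl
      agree 2 (s≤s (s≤s (s≤s _))) = refl
      agree 3 (s≤s (s≤s (s≤s (s≤s _)))) = refl
      agree (suc (suc (suc (suc _)))) (s≤s (s≤s (s≤s (s≤s ()))))

-- Graph isomorphisms and group isomorphisms

open GraphIso using (pres; refl′) renaming (bij to vertices)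

module Translation (G : FiniteGroup) (m : ℕ) where
  open Elements G

  infixl 7 _⊛_
  _⊛_ : Vec Element m → Vec Element m → Vec Element m
  _⊛_ = zipWith _·_

  inverse : Vec Element m → Vec Element m
  inverse = map _⁻

  ⊛-cancelʳ : ∀ g k → g ⊛ inverse k ⊛ k ≡ g
  ⊛-cancelʳ g k = trans (zipWith-assoc assoc g (inverse k) k)
    (trans (cong (g ⊛_) (zipWith-inverseˡ inverseˡ k)) (zipWith-identityʳ identityʳ g))

  ⊛-cancelʳ′ : ∀ g k → g ⊛ k ⊛ inverse k ≡ g
  ⊛-cancelʳ′ g k = trans (zipWith-assoc assoc g k (inverse k))
    (trans (cong (g ⊛_) (zipWith-inverseʳ inverseʳ k)) (zipWith-identityʳ identityʳ g))

  -- Connecting elements multiply on the left, so right translations respect adjacency.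
  adj-⊛ : ∀ {g h} k → Adj G m g h → Adj G m (g ⊛ k) (h ⊛ k)
  adj-⊛ {g} k (s , s∈S , refl) = s , s∈S , zipWith-assoc assoc s g k

module _ {G H : FiniteGroup} {m : ℕ} (Φ : GraphIso G H m) where
  private
    module G = Elements G
    module H = Elements H
    module GC = Code (G.code m)
    module HC = Code (H.code m)
    open Translation H m

    φ : Vec G.Element m → Vec H.Element m
    φ = Inverse.to (vertices Φ)

    φ⁻¹ : Vec H.Element m → Vec G.Element m
    φ⁻¹ = Inverse.from (vertices Φ)

    φ-injective : ∀ {u v} → φ u ≡ φ v → u ≡ v
    φ-injective e = trans (sym (Inverse.strictlyInverseʳ (vertices Φ) _))
      (trans (cong φ⁻¹ e) (Inverse.strictlyInverseʳ (vertices Φ) _))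

    𝐨 : Vec G.Element m
    𝐨 = replicate m G.𝟙

    to : Vec G.Element m → Vec H.Element m
    to g = φ g ⊛ inverse (φ 𝐨)

    to-φ : ∀ g → to g ⊛ φ 𝐨 ≡ φ g
    to-φ g = ⊛-cancelʳ (φ g) (φ 𝐨)

    to-injective : ∀ {u v} → to u ≡ to v → u ≡ v
    to-injective {u} {v} e = φ-injective
      (trans (sym (to-φ u)) (trans (cong (_⊛ φ 𝐨) e) (to-φ v)))

    to-near : ∀ {u v} → GC.Near u v → HC.Near (to u) (to v)
    to-near {u} {v} n with ≡-dec G._≟ᵉ_ u v
    ... | yes refl = zero , zero , λ _ _ → refl
    ... | no u≢v   = H.adj⇒near (adj-⊛ (inverse (φ 𝐨)) (pres Φ u v (G.near⇒adj n u≢v)))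

    to-near⁻¹ : ∀ {u v} → HC.Near (to u) (to v) → GC.Near u v
    to-near⁻¹ {u} {v} n with ≡-dec G._≟ᵉ_ u v
    ... | yes refl = zero , zero , λ _ _ → refl
    ... | no u≢v   = G.adj⇒near (refl′ Φ u v (subst₂ (Adj H m) (to-φ u) (to-φ v)
                       (adj-⊛ (φ 𝐨) (H.near⇒adj n (u≢v ∘ to-injective)))))

  pointed-code-iso : CodeIso (G.code m) (H.code m)
  pointed-code-iso = record
    { to        = to
    ; from      = λ h → φ⁻¹ (h ⊛ φ 𝐨)
    ; to-from   = λ h → trans (cong (_⊛ inverse (φ 𝐨)) (Inverse.strictlyInverseˡ (vertices Φ) _))
                          (⊛-cancelʳ′ h (φ 𝐨))
    ; injective = to-injective
    ; to-near   = to-near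
    ; to-near⁻¹ = to-near⁻¹
    }

  pointed-code-iso-origin : ∀ i → H.coords H.𝟙 (CodeIso.to pointed-code-iso 𝐨) i ≡ H.𝟙
  pointed-code-iso-origin i = trans
    (cong (λ v → H.coords H.𝟙 v i) (zipWith-inverseʳ H.inverseʳ (φ 𝐨))) (H.coords-replicate m i)

graph-iso-sym : ∀ {G H m} → GraphIso G H m → GraphIso H G m
graph-iso-sym {G} {H} {m} Φ = record
  { bij   = ↔-sym (vertices Φ)
  ; pres  = λ g h a → refl′ Φ _ _ (subst₂ (Adj H m) (sym (right g)) (sym (right h)) a)
  ; refl′ = λ g h a → subst₂ (Adj H m) (right g) (right h) (pres Φ _ _ a)
  }
  where right = Inverse.strictlyInverseˡ (vertices Φ)

-- Words supported on two or three positions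

module _ (G : FiniteGroup) (m : ℕ) where
  open Elements G
  open Code (code m) using (Off)

  private variable
    n : ℕ

  prod-word : (v : Vec Element m) → prod (coords 𝟙 v) ≡ 𝟙
  prod-word v = trans (prod-coords 𝟙 v) ε⁻¹≈ε

  support₂ : ∀ {o v} → (∀ i → coords 𝟙 o i ≡ 𝟙) → ∀ {i j} → Off o v i j → i ≢ j →
             coords 𝟙 v j ≡ coords 𝟙 v i ⁻
  support₂ {o} {v} o-at {i} {j} ov i≢j with Fin.<-cmp i j
  ... | tri< i<j _ _ = inverseʳ-unique _ _
    (trans (sym (prod₂ i j i<j λ l l≢i l≢j → trans (sym (ov l≢i l≢j)) (o-at l))) (prod-word v))
  ... | tri≈ _ i≡j _ = ⊥-elim (i≢j i≡j)
  ... | tri> _ _ j<i = inverseˡ-unique _ _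
    (trans (sym (prod₂ j i j<i λ l l≢j l≢i → trans (sym (ov l≢i l≢j)) (o-at l))) (prod-word v))

  Support₃ : Fin n → Fin n → Fin n → (Fin n → Element) → Set
  Support₃ p q r w = ∀ {l} → l ≢ p → l ≢ q → l ≢ r → w l ≡ 𝟙

  -- The positions may come in any order. A product equal to `𝟙` can be rotated, so the six orders
  -- fall into two classes, exchanged by reversal.
  prod₃-up-to-reversal : {p q r : Fin n} → p ≢ q → p ≢ r → q ≢ r →
    (∀ w → Support₃ p q r w → prod w ≡ 𝟙 → w p · w q · w r ≡ 𝟙) ⊎
    (∀ w → Support₃ p q r w → prod w ≡ 𝟙 → w r · w q · w p ≡ 𝟙)
  prod₃-up-to-reversal {p = p} {q} {r} p≢q p≢r q≢r with Fin.<-cmp p q | Fin.<-cmp q r | Fin.<-cmp p r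
  ... | tri≈ _ e _ | _ | _ = ⊥-elim (p≢q e)
  ... | tri< _ _ _ | tri≈ _ e _ | _ = ⊥-elim (q≢r e)
  ... | tri> _ _ _ | tri≈ _ e _ | _ = ⊥-elim (q≢r e)
  ... | tri< p<q _ _ | tri< q<r _ _ | _ = inj₁ λ w s e →
    trans (sym (prod₃ p q r p<q q<r λ _ l≢p l≢q l≢r → s l≢p l≢q l≢r)) e
  ... | tri< p<q _ _ | tri> _ _ r<q | tri< p<r _ _ = inj₂ λ w s e →
    rotate (trans (sym (prod₃ p r q p<r r<q λ _ l≢p l≢r l≢q → s l≢p l≢q l≢r)) e)
  ... | tri< _ _ _ | tri> _ _ _ | tri≈ _ e _ = ⊥-elim (p≢r e)
  ... | tri< p<q _ _ | tri> _ _ r<q | tri> _ _ r<p = inj₁ λ w s e →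
    rotate (trans (sym (prod₃ r p q r<p p<q λ _ l≢r l≢p l≢q → s l≢p l≢q l≢r)) e)
  ... | tri> _ _ q<p | tri> _ _ r<q | _ = inj₂ λ w s e →
    trans (sym (prod₃ r q p r<q q<p λ _ l≢r l≢q l≢p → s l≢p l≢q l≢r)) e
  ... | tri> _ _ q<p | tri< q<r _ _ | tri< p<r _ _ = inj₂ λ w s e →
    rotate (rotate (trans (sym (prod₃ q p r q<p p<r λ _ l≢q l≢p l≢r → s l≢p l≢q l≢r)) e))
  ... | tri> _ _ _ | tri< _ _ _ | tri≈ _ e _ = ⊥-elim (p≢r e)
  ... | tri> _ _ q<p | tri< q<r _ _ | tri> _ _ r<p = inj₁ λ w s e →
    rotate (rotate (trans (sym (prod₃ q r p q<r r<p λ _ l≢q l≢r l≢p → s l≢p l≢q l≢r)) e))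

-- From an isotopy to a homomorphism

module _ (G H : FiniteGroup) where
  private
    module G = Elements G
    module H = Elements H

  private
    -- Putting `𝟙` for `y`, then for `x`, expresses `h` by `f` and `g` by `h`, which gives
    -- `g y ≡ f y`. The relation with `z` inverse to `x G.· y` is then multiplicativity.
    module Isotopy {f g h : G.Element → H.Element}
      (f𝟙 : f G.𝟙 ≡ H.𝟙) (g𝟙 : g G.𝟙 ≡ H.𝟙) (h𝟙 : h G.𝟙 ≡ H.𝟙)
      (rel : ∀ x y z → x G.· y G.· z ≡ G.𝟙 → f x H.· g y H.· h z ≡ H.𝟙) where

      h-f : ∀ x → h x ≡ f (x G.⁻) H.⁻
      h-f x = H.inverseʳ-unique _ _ (begin
        f (x G.⁻) H.· h x             ≡⟨ cong (H._· h x) (trans (cong (_ H.·_) g𝟙) (H.identityʳ _)) ⟨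
        f (x G.⁻) H.· g G.𝟙 H.· h x   ≡⟨ rel (x G.⁻) G.𝟙 x
                                            (trans (cong (G._· x) (G.identityʳ _)) (G.inverseˡ x)) ⟩
        H.𝟙                           ∎)
        where open ≡-Reasoning

      g-h : ∀ y → g y ≡ h (y G.⁻) H.⁻
      g-h y = H.inverseˡ-unique _ _ (begin
        g y H.· h (y G.⁻)             ≡⟨ cong (H._· h (y G.⁻)) (trans (cong (H._· g y) f𝟙) (H.identityˡ _)) ⟨
        f G.𝟙 H.· g y H.· h (y G.⁻)   ≡⟨ rel G.𝟙 y (y G.⁻)
                                            (trans (cong (G._· (y G.⁻)) (G.identityˡ _)) (G.inverseʳ y)) ⟩
        H.𝟙                           ∎)
        where open ≡-Reasoning

      g-f : ∀ y → g y ≡ f y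
      g-f y = begin
        g y                          ≡⟨ g-h y ⟩
        h (y G.⁻) H.⁻                ≡⟨ cong H._⁻ (h-f (y G.⁻)) ⟩
        f (y G.⁻ G.⁻) H.⁻ H.⁻        ≡⟨ H.⁻¹-involutive _ ⟩
        f (y G.⁻ G.⁻)                ≡⟨ cong f (G.⁻¹-involutive y) ⟩
        f y                          ∎
        where open ≡-Reasoning

      hom : ∀ x y → f (x G.· y) ≡ f x H.· f y
      hom x y = begin
        f (x G.· y)                  ≡⟨ cong f (G.⁻¹-involutive _) ⟨
        f ((x G.· y) G.⁻ G.⁻)        ≡⟨ H.⁻¹-involutive _ ⟨
        f ((x G.· y) G.⁻ G.⁻) H.⁻ H.⁻ ≡⟨ cong H._⁻ (h-f _) ⟨
        h ((x G.· y) G.⁻) H.⁻        ≡⟨ H.inverseˡ-unique _ _ (rel x y _ (G.inverseʳ _)) ⟨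
        f x H.· g y                  ≡⟨ cong (f x H.·_) (g-f y) ⟩
        f x H.· f y                  ∎
        where open ≡-Reasoning

  -- Inversion reverses products, so composing the three maps with it turns a reversed relation into
  -- a direct one. The homomorphism is then built from `h` in place of `f`.
  isotopy⇒hom : ∀ {f g h : G.Element → H.Element} →
    (∀ {x y} → f x ≡ f y → x ≡ y) → f G.𝟙 ≡ H.𝟙 → g G.𝟙 ≡ H.𝟙 → h G.𝟙 ≡ H.𝟙 →
    (∀ x y z → x G.· y G.· z ≡ G.𝟙 → f x H.· g y H.· h z ≡ H.𝟙) ⊎
    (∀ x y z → x G.· y G.· z ≡ G.𝟙 → h z H.· g y H.· f x ≡ H.𝟙) →
    ∃ λ (k : G.Element → H.Element) →
      (∀ {x y} → k x ≡ k y → x ≡ y) × (∀ x y → k (x G.· y) ≡ k x H.· k y)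
  isotopy⇒hom {f} {g} {h} f-inj f𝟙 g𝟙 h𝟙 (inj₁ rel) = f , f-inj , Isotopy.hom f𝟙 g𝟙 h𝟙 rel
  isotopy⇒hom {f} {g} {h} f-inj f𝟙 g𝟙 h𝟙 (inj₂ rel) = k , k-inj , I.hom
    where
    k : G.Element → H.Element
    k x = h (x G.⁻)

    at-𝟙 : ∀ (f : G.Element → H.Element) → f G.𝟙 ≡ H.𝟙 → f (G.𝟙 G.⁻) ≡ H.𝟙
    at-𝟙 f f𝟙 = trans (cong f G.ε⁻¹≈ε) f𝟙

    rel′ : ∀ x y z → x G.· y G.· z ≡ G.𝟙 → k x H.· g (y G.⁻) H.· f (z G.⁻) ≡ H.𝟙
    rel′ x y z e = rel (z G.⁻) (y G.⁻) (x G.⁻) (begin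
      z G.⁻ G.· y G.⁻ G.· x G.⁻    ≡⟨ G.assoc _ _ _ ⟩
      z G.⁻ G.· (y G.⁻ G.· x G.⁻)  ≡⟨ cong (z G.⁻ G.·_) (G.⁻¹-anti-homo-∙ x y) ⟨
      z G.⁻ G.· (x G.· y) G.⁻      ≡⟨ G.⁻¹-anti-homo-∙ (x G.· y) z ⟨
      (x G.· y G.· z) G.⁻          ≡⟨ cong G._⁻ e ⟩
      G.𝟙 G.⁻                      ≡⟨ G.ε⁻¹≈ε ⟩
      G.𝟙                          ∎)
      where open ≡-Reasoning

    module I = Isotopy {k} {λ y → g (y G.⁻)} {λ z → f (z G.⁻)}
      (at-𝟙 h h𝟙) (at-𝟙 g g𝟙) (at-𝟙 f f𝟙) rel′

    f≡k⁻ : ∀ x → f x ≡ k x H.⁻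
    f≡k⁻ x = subst (λ x → f x ≡ k x H.⁻) (G.⁻¹-involutive x) (I.h-f (x G.⁻))

    k-inj : ∀ {x y} → k x ≡ k y → x ≡ y
    k-inj {x} {y} e = f-inj (trans (f≡k⁻ x) (trans (cong H._⁻ e) (sym (f≡k⁻ y))))

module _ (G H : FiniteGroup) (n : ℕ) (sizes : size G ≡ size H) where
  private
    m : ℕ
    m = suc (suc n)

    module G where
      open Elements G public
      open Counting G public
      open Code (code m) public
    module H where
      open Elements H public
      open Counting H public
      open Code (code m) public

    𝐨 : G.Word
    𝐨 = replicate m G.𝟙

    0≢1 : ∀ {n} → _≢_ {A = Fin (suc (suc n))} zero (suc zero)
    0≢1 ()

    0≢2 : ∀ {n} → _≢_ {A = Fin (suc (suc (suc n)))} zero (suc (suc zero))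
    0≢2 ()

    1≢2 : ∀ {n} → _≢_ {A = Fin (suc (suc (suc n)))} (suc zero) (suc (suc zero))
    1≢2 ()

  module _ {φ : G.Word → H.Word} (φ𝐨-at : ∀ i → H.coords H.𝟙 (φ 𝐨) i ≡ H.𝟙)
    {p q r : H.Pos} (p≢q : p ≢ q) (p≢r : p ≢ r) (q≢r : q ≢ r)
    {f g h : G.Element → H.Element}
    (coordinates : ∀ v →
      (∀ {l} → l ≢ zero → l ≢ suc zero → l ≢ suc (suc zero) → G.coords G.𝟙 v l ≡ G.𝟙) →
      H.coords H.𝟙 (φ v) p ≡ f (G.coords G.𝟙 v zero) ×
      H.coords H.𝟙 (φ v) q ≡ g (G.coords G.𝟙 v (suc zero)) ×
      H.coords H.𝟙 (φ v) r ≡ h (G.coords G.𝟙 v (suc (suc zero))) ×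
      Support₃ H m p q r (H.coords H.𝟙 (φ v))) where

    private
      at-𝐨 = coordinates 𝐨 λ {l} _ _ _ → G.coords-replicate m l

      f𝟙 : f G.𝟙 ≡ H.𝟙
      f𝟙 = trans (cong f (sym (G.coords-replicate m zero)))
             (trans (sym (proj₁ at-𝐨)) (φ𝐨-at p))

      g𝟙 : g G.𝟙 ≡ H.𝟙
      g𝟙 = trans (cong g (sym (G.coords-replicate m (suc zero))))
             (trans (sym (proj₁ (proj₂ at-𝐨))) (φ𝐨-at q))

      h𝟙 : h G.𝟙 ≡ H.𝟙
      h𝟙 = trans (cong h (sym (G.coords-replicate m (suc (suc zero)))))
             (trans (sym (proj₁ (proj₂ (proj₂ at-𝐨)))) (φ𝐨-at r))

      word : G.Element → G.Element → G.Element → Fin (suc m) → G.Element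
      word x y z zero                = x
      word x y z (suc zero)          = y
      word x y z (suc (suc zero))    = z
      word x y z (suc (suc (suc _))) = G.𝟙

      prod-word-≡ : ∀ x y z → x G.· y G.· z ≡ G.𝟙 → G.prod (word x y z) ≡ G.𝟙 G.⁻
      prod-word-≡ x y z e = begin
        x G.· (y G.· (z G.· G.prod {n} (λ _ → G.𝟙)))  ≡⟨ cong (λ t → x G.· (y G.· (z G.· t)))
                                                             (G.prod₀ {n} λ _ → refl) ⟩
        x G.· (y G.· (z G.· G.𝟙))                      ≡⟨ cong (λ t → x G.· (y G.· t)) (G.identityʳ z) ⟩
        x G.· (y G.· z)                                ≡⟨ G.assoc x y z ⟨
        x G.· y G.· z                                  ≡⟨ e ⟩
        G.𝟙                                            ≡⟨ G.ε⁻¹≈ε ⟨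
        G.𝟙 G.⁻                                        ∎
        where open ≡-Reasoning

      triple : ∀ x y z → x G.· y G.· z ≡ G.𝟙 → ∃ λ w →
        w p ≡ f x × w q ≡ g y × w r ≡ h z × Support₃ H m p q r w × H.prod w ≡ H.𝟙
      triple x y z e = H.coords H.𝟙 (φ v) ,
        trans (proj₁ c) (cong f (v≡w zero)) ,
        trans (proj₁ (proj₂ c)) (cong g (v≡w (suc zero))) ,
        trans (proj₁ (proj₂ (proj₂ c))) (cong h (v≡w (suc (suc zero)))) ,
        (λ {l} → proj₂ (proj₂ (proj₂ c)) {l}) , prod-word H m (φ v)
        where
        v-word = G.coords-surjective G.𝟙 (word x y z) (prod-word-≡ x y z e)

        v : G.Word
        v = proj₁ v-word

        v≡w : ∀ l → G.coords G.𝟙 v l ≡ word x y z l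
        v≡w = proj₂ v-word

        outside : ∀ l → l ≢ zero → l ≢ suc zero → l ≢ suc (suc zero) → G.coords G.𝟙 v l ≡ G.𝟙
        outside zero                l≢ _ _ = ⊥-elim (l≢ refl)
        outside (suc zero)          _ l≢ _ = ⊥-elim (l≢ refl)
        outside (suc (suc zero))    _ _ l≢ = ⊥-elim (l≢ refl)
        outside (suc (suc (suc l))) _ _ _  = v≡w (suc (suc (suc l)))

        c = coordinates v λ {l} → outside l

      relation : (∀ x y z → x G.· y G.· z ≡ G.𝟙 → f x H.· g y H.· h z ≡ H.𝟙) ⊎
                 (∀ x y z → x G.· y G.· z ≡ G.𝟙 → h z H.· g y H.· f x ≡ H.𝟙)
      relation with prod₃-up-to-reversal H m p≢q p≢r q≢r
      ... | inj₁ pqr = inj₁ λ x y z e → let (w , wp , wq , wr , s , e′) = triple x y z e in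
        trans (cong₂ H._·_ (cong₂ H._·_ (sym wp) (sym wq)) (sym wr)) (pqr w s e′)
      ... | inj₂ rqp = inj₂ λ x y z e → let (w , wp , wq , wr , s , e′) = triple x y z e in
        trans (cong₂ H._·_ (cong₂ H._·_ (sym wr) (sym wq)) (sym wp)) (rqp w s e′)

    plane⇒hom : (∀ {x y} → f x ≡ f y → x ≡ y) → ∃ λ (k : G.Element → H.Element) →
      (∀ {x y} → k x ≡ k y → x ≡ y) × (∀ x y → k (x G.· y) ≡ k x H.· k y)
    plane⇒hom f-inj = isotopy⇒hom G H f-inj f𝟙 g𝟙 h𝟙 relation

  -- Since `m > 1`, a word has at least three positions, enough for one plane.
  large-iso : 5 ℕ.≤ size G → GraphIso G H m → GroupIso G H
  large-iso 5≤n Φ =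
    let (p , q , r , p≢q , p≢r , q≢r , f , g , h , f-inj , coordinates) =
          Planes.plane-isotopy (pointed-code-iso Φ) fresh {o = 𝐨} (G.coords-replicate m)
            (pointed-code-iso-origin Φ) {zero} {suc zero} {suc (suc zero)} 0≢1 0≢2 1≢2
        (k , k-inj , k-hom) =
          plane⇒hom {CodeIso.to (pointed-code-iso Φ)} (pointed-code-iso-origin Φ) p≢q p≢r q≢r
            {f} {g} {h} (λ v → coordinates {v}) f-inj
    in injective-hom⇒iso G H sizes k k-inj k-hom
    where
    fresh : ∀ a b c d → ∃ λ q → q ≢ a × q ≢ b × q ≢ c × q ≢ d
    fresh a b c d with G.fresh (a ∷ b ∷ c ∷ d ∷ []) 5≤n
    ... | q , q∉ = q , q∉ ∘ here , q∉ ∘ there ∘ here , q∉ ∘ there ∘ there ∘ here ,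
                   q∉ ∘ there ∘ there ∘ there ∘ here

  -- The third element `s` provides a common neighbour on the line of the edge itself.
  exponent-2-transfer : 3 ℕ.≤ size G → GraphIso G H m →
    (∀ y → y H.· y ≡ H.𝟙) → ∀ x → x G.· x ≡ G.𝟙
  exponent-2-transfer 3≤n Φ squares x with x G.· x G.≟ᵉ G.𝟙
  ... | yes e = e
  ... | no x²≢𝟙 with G.fresh (G.𝟙 ∷ x ∷ []) 3≤n
  ...   | s , s∉ = ⊥-elim (no-iso-to-self-inverse (pointed-code-iso Φ) {𝐨}
    (G.coords-replicate m) (pointed-code-iso-origin Φ) G._⁻ H._⁻ G.⁻¹-involutive
    (λ y → sym (H.inverseʳ-unique y y (squares y)))
    (λ {v} → support₂ G m {𝐨} {v} (G.coords-replicate m))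
    (λ {v} → support₂ H m {CodeIso.to (pointed-code-iso Φ) 𝐨} {v} (pointed-code-iso-origin Φ))
    {zero} {suc zero} {suc (suc zero)} {x} {s} 0≢1 0≢2 1≢2
    (λ e → x²≢𝟙 (trans (cong (x G.·_) e) (G.inverseʳ x)))
    (λ { refl → x²≢𝟙 (G.identityˡ G.𝟙) })
    (s∉ ∘ here) (s∉ ∘ there ∘ here))

graph-iso⇒group-iso : ∀ G H n → GraphIso G H (suc (suc n)) → GroupIso G H
graph-iso⇒group-iso G H n Φ = by-size (size G ℕ.≤? 3) (size G ℕ.≤? 4)
  where
  module G = Elements G
  module H = Elements H

  sizes : size G ≡ size H
  sizes = Vec-↔⇒size-≡ G H (suc (suc n)) (vertices Φ)

  order-4 : size G ≡ 4 → GroupIso G H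
  order-4 n≡4 with Counting.decide-all G (λ x → x G.· x G.≟ᵉ G.𝟙)
                 | Counting.decide-all H (λ y → y H.· y H.≟ᵉ H.𝟙)
  ... | inj₁ sqG | inj₁ sqH = small-iso G H sizes (inj₂ (ℕ.≤-reflexive n≡4 , sqG , sqH))
  ... | inj₂ (x , x²) | inj₂ (y , y²) = cyclic-iso G H sizes x y n≡4
    (OrderFour.pow-4 G n≡4 x²) (OrderFour.pow-4 H n≡4′ y²)
    (OrderFour.pow-injective G n≡4 x²) (OrderFour.pow-injective H n≡4′ y²)
    where n≡4′ = trans (sym sizes) n≡4
  ... | inj₁ sqG | inj₂ (y , y²) = ⊥-elim (y² (exponent-2-transfer H G n (sym sizes)
    (ℕ.≤-trans (ℕ.n≤1+n 3) (ℕ.≤-reflexive (sym (trans (sym sizes) n≡4)))) (graph-iso-sym Φ) sqG y))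
  ... | inj₂ (x , x²) | inj₁ sqH = ⊥-elim (x² (exponent-2-transfer G H n sizes
    (ℕ.≤-trans (ℕ.n≤1+n 3) (ℕ.≤-reflexive (sym n≡4))) Φ sqH x))

  by-size : Dec (size G ℕ.≤ 3) → Dec (size G ℕ.≤ 4) → GroupIso G H
  by-size (yes ≤3) _        = small-iso G H sizes (inj₁ ≤3)
  by-size (no ≰3) (yes ≤4) = order-4 (ℕ.≤-antisym ≤4 (ℕ.≰⇒> ≰3))
  by-size (no _)  (no ≰4)  = large-iso G H n sizes (ℕ.≰⇒> ≰4) Φ

-- Group isomorphisms induce graph isomorphisms

open GroupIso using (hom) renaming (bij to elements)

module _ {G H : FiniteGroup} (Ψ : GroupIso G H) where
  private
    module G = Elements G
    module H = Elements H

    f : G.Element → H.Element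
    f = Inverse.to (elements Ψ)

    f⁻¹ : H.Element → G.Element
    f⁻¹ = Inverse.from (elements Ψ)

    f-f⁻¹ : ∀ y → f (f⁻¹ y) ≡ y
    f-f⁻¹ = Inverse.strictlyInverseˡ (elements Ψ)

    f⁻¹-f : ∀ x → f⁻¹ (f x) ≡ x
    f⁻¹-f = Inverse.strictlyInverseʳ (elements Ψ)

    f𝟙 : f G.𝟙 ≡ H.𝟙
    f𝟙 = H.∙-cancelˡ (f G.𝟙) _ _
      (trans (sym (hom Ψ G.𝟙 G.𝟙)) (trans (cong f (G.identityˡ G.𝟙)) (sym (H.identityʳ _))))

    map-interval : ∀ x m k l → map f (G.interval x {m} k l) ≡ H.interval (f x) k l
    map-interval x zero    _       _       = refl
    map-interval x (suc m) zero    zero    = cong₂ _∷_ f𝟙 (map-interval x m zero zero)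
    map-interval x (suc m) zero    (suc l) = cong (f x ∷_) (map-interval x m zero l)
    map-interval x (suc m) (suc k) zero    = cong₂ _∷_ f𝟙 (map-interval x m k zero)
    map-interval x (suc m) (suc k) (suc l) = cong₂ _∷_ f𝟙 (map-interval x m k l)

    map-hom : ∀ {m} (s g : Vec G.Element m) → map f (zipWith G._·_ s g) ≡
              zipWith H._·_ (map f s) (map f g)
    map-hom []      []      = refl
    map-hom (x ∷ s) (y ∷ g) = cong₂ _∷_ (hom Ψ x y) (map-hom s g)

  map-adj : ∀ {m g h} → Adj G m g h → Adj H m (map f g) (map f h)
  map-adj {m} {g} (s , (x , k , l , x≢𝟙 , k<l , l≤m , refl) , refl) =
    map f s ,
    (f x , k , l ,
      (λ e → x≢𝟙 (trans (sym (f⁻¹-f x)) (trans (cong f⁻¹ (trans e (sym f𝟙))) (f⁻¹-f G.𝟙)))) ,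
      k<l , l≤m ,
      trans (cong (map f) (G.intervalElem≡interval x m k l))
        (trans (map-interval x m k l) (sym (H.intervalElem≡interval (f x) m k l)))) ,
    map-hom s g

  group-iso-sym : GroupIso H G
  group-iso-sym = record
    { bij = ↔-sym (elements Ψ)
    ; hom = λ x y → trans (cong f⁻¹ (trans (cong₂ H._·_ (sym (f-f⁻¹ x)) (sym (f-f⁻¹ y)))
                             (sym (hom Ψ (f⁻¹ x) (f⁻¹ y))))) (f⁻¹-f _)
    }

  map-f-f⁻¹ : ∀ {m} (h : Vec H.Element m) → map f (map f⁻¹ h) ≡ h
  map-f-f⁻¹ h = trans (sym (map-∘ f f⁻¹ h)) (trans (map-cong f-f⁻¹ h) (map-id h))

  map-f⁻¹-f : ∀ {m} (g : Vec G.Element m) → map f⁻¹ (map f g) ≡ g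
  map-f⁻¹-f g = trans (sym (map-∘ f⁻¹ f g)) (trans (map-cong f⁻¹-f g) (map-id g))

group-iso⇒graph-iso : ∀ G H m → GroupIso G H → GraphIso G H m
group-iso⇒graph-iso G H m Ψ = record
  { bij   = mk↔ₛ′ (map (Inverse.to (elements Ψ))) (map (Inverse.from (elements Ψ)))
              (map-f-f⁻¹ Ψ) (map-f⁻¹-f Ψ)
  ; pres  = λ _ _ → map-adj Ψ
  ; refl′ = λ g h a → subst₂ (Adj G m) (map-f⁻¹-f Ψ g) (map-f⁻¹-f Ψ h) (map-adj (group-iso-sym Ψ) a)
  }

theorem6p12 : (G H : FiniteGroup) (m : ℕ) → 1 < m →
    (GraphIso G H m → GroupIso G H) × (GroupIso G H → GraphIso G H m)
theorem6p12 G H (suc (suc n)) _ = graph-iso⇒group-iso G H n , group-iso⇒graph-iso G H (suc (suc n))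
theorem6p12 G H (suc zero) (s≤s ())
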